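{- Let $n\ge2$ be even and let $y,z\in\tilde I^{\mathsf{FPF}}_n$ with $y\lessdot_F z$. Then the map $(\pi,t)\mapsto\pi t$ is a bijection from the set of pairs $(\pi,t)\in\mathcal A^{\mathsf{FPF}}(y)\times R(\tilde S_n)$ with $\pi\lessdot\pi t$ and $z=tyt$ onto $\mathcal A^{\mathsf{FPF}}(z)$.
   Context: $\tilde S_n$ is the group of bijections $\pi:\mathbb Z\to\mathbb Z$ with $\pi(i+n)=\pi(i)+n$ and $\sum_{i=1}^n\pi(i)=\sum_{i=1}^n i$, a Coxeter group with generators $s_1,\dots,s_n$ ($s_i$ swaps $i+kn,i+1+kn$ for all $k$) and length $\ell$. $R(\tilde S_n)$ is the set of reflections, namely the elements $t_{ij}$ ($i<j$, $j\not\equiv i\pmod n$) exchanging $i+kn,j+kn$ for all $k$ and fixing other integers. $\pi\lessdot\sigma$ denotes a cover in the Bruhat order of $\tilde S_n$: $\sigma=\pi t$ for some reflection $t$ and $\ell(\sigma)=\ell(\pi)+1$. $\tilde I^{\mathsf{FPF}}_n$ is the set of $z\in\tilde S_n$ with $z(z(i))=i\neq z(i)$ for all $i$. With $\Theta^+=s_1s_3\cdots s_{n-1}$, $\Theta^-=s_2s_4\cdots s_n$, each $z$ is conjugate to exactly one $\Theta\in\{\Theta^\pm\}$; $\mathcal A^{\mathsf{FPF}}(z)$ is the set of minimal-length $w$ with $w^{ -1}\Theta w=z$. $\hat\ell_{\mathsf{FPF}}(z)=\frac12(\ell(z)-\frac n2)$, and $y\lessdot_F z$ means $z=tyt$ for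 some reflection $t$ and $\hat\ell_{\mathsf{FPF}}(z)=\hat\ell_{\mathsf{FPF}}(y)+1$. -}

module Defs where

open import Data.Bool using (Bool; true; false; if_then_else_)
open import Data.Nat as ℕ using (ℕ; zero; suc; ⌊_/2⌋)
open import Data.Nat.Divisibility using (_∣_; _∣?_)
open import Data.Integer as ℤ using (ℤ; +_; _+_; _-_; ∣_∣)
open import Data.List using (List; []; _∷_; map; foldr; length; upTo)
open import Data.List.Relation.Unary.All using (All)
open import Data.Product using (Σ; ∃; _×_)
open import Relation.Nullary using (¬_; does)
open import Relation.Binary.PropositionalEquality using (_≡_; _≢_)
open import Function using (_∘_)

-- Raw maps ℤ → ℤ; elements of S̃_n are those satisfying IsAffPerm n.
Map : Set
Map = ℤ → ℤ

-- Pointwise (extensional) equality of maps; this is equality in S̃_n.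
infix 4 _≈_
_≈_ : Map → Map → Set
f ≈ g = ∀ x → f x ≡ g x

Cong : ℕ → ℤ → ℤ → Set
Cong n a b = n ∣ ∣ a - b ∣

congᵇ : ℕ → ℤ → ℤ → Bool
congᵇ n a b = does (n ∣? ∣ a - b ∣)

sumℤ : List ℤ → ℤ
sumℤ = foldr _+_ (+ 0)

IsAffPerm : ℕ → Map → Set
IsAffPerm n f =
  (Σ Map λ g → ∀ x → g (f x) ≡ x × f (g x) ≡ x)
  × (∀ x → f (x + + n) ≡ f x + + n)
  × (sumℤ (map (λ k → f (+ suc k)) (upTo n)) ≡ sumℤ (map (λ k → + suc k) (upTo n)))

gen : ℕ → ℕ → Map
gen n i x =
  if congᵇ n x (+ i) then x + + 1
  else if congᵇ n x (+ suc i) then x - + 1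
  else x

refl-t : ℕ → ℤ → ℤ → Map
refl-t n i j x =
  if congᵇ n x i then x + (j - i)
  else if congᵇ n x j then x - (j - i)
  else x

IsReflection : ℕ → Map → Set
IsReflection n t = Σ ℤ λ i → Σ ℤ λ j → (i ℤ.< j) × ¬ Cong n j i × (t ≈ refl-t n i j)

InRange : ℕ → ℕ → Set
InRange n i = (1 ℕ.≤ i) × (i ℕ.≤ n)

prod : ℕ → List ℕ → Map
prod n []      x = x
prod n (i ∷ w) x = gen n i (prod n w x)

IsLength : ℕ → Map → ℕ → Set
IsLength n f k =
  (Σ (List ℕ) λ w → All (InRange n) w × length w ≡ k × prod n w ≈ f)
  × (∀ w → All (InRange n) w → prod n w ≈ f → k ℕ.≤ length w)

Cover : ℕ → Map → Map → Set
Cover n π σ =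
  IsAffPerm n π × IsAffPerm n σ
  × (Σ Map λ t → IsReflection n t × σ ≈ (π ∘ t))
  × (∃ λ k → IsLength n π k × IsLength n σ (suc k))

IsFPFInv : ℕ → Map → Set
IsFPFInv n z = IsAffPerm n z × (∀ i → z (z i) ≡ i × z i ≢ i)

-- ℓ̂_FPF(z) = ½(ℓ(z) − n/2);  ℓ̂_FPF(z) = ℓ̂_FPF(y) + 1  ⟺  ℓ(z) = ℓ(y) + 2
FPFCover : ℕ → Map → Map → Set
FPFCover n y z =
  (Σ Map λ t → IsReflection n t × z ≈ (t ∘ y ∘ t))
  × (∃ λ k → IsLength n y k × IsLength n z (k ℕ.+ 2))

Θ : ℕ → Bool → Map
Θ n true  = prod n (map (λ k → 1 ℕ.+ 2 ℕ.* k) (upTo ⌊ n /2⌋))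
Θ n false = prod n (map (λ k → 2 ℕ.+ 2 ℕ.* k) (upTo ⌊ n /2⌋))

-- w ∈ 𝒜^FPF(y): w ∈ S̃_n, w⁻¹ Θ w = y (written Θ w = w y) for Θ ∈ {Θ⁺,Θ⁻},
-- and w has minimal length among all such v ∈ S̃_n (for that same Θ).
AFPF : ℕ → Map → Map → Set
AFPF n y w =
  IsAffPerm n w ×
  (Σ Bool λ b → ((Θ n b ∘ w) ≈ (w ∘ y))
     × (∃ λ k → IsLength n w k
          × (∀ v → IsAffPerm n v → (Θ n b ∘ v) ≈ (v ∘ y)
                 → ∀ m → IsLength n v m → k ℕ.≤ m)))

GoodPair : ℕ → Map → Map → Map → Map → Set
GoodPair n y z π t =
  AFPF n y π × IsReflection n t × Cover n π (π ∘ t) × z ≈ (t ∘ y ∘ t)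

{-# OPTIONS --safe #-}
-- For an FPF involution z, the least length of w with Θ w = w z is (ℓ(z) − ℓ(Θ))/2: conjugating
-- by a simple reflection at a descent shortens z by two until z = Θ⁺ or z = Θ⁻, and these two are not
-- conjugate.  So if z = t y t covers y, atoms of z are one longer than atoms of y, and a pair (π, t) is
-- the same as an atom w = π t of z with an inversion t such that t z t = y.  By minimality no v with
-- Θ v = v y inverts such a t.  The reflections conjugating z to y are t and, when it commutes with t,
-- z t z.  Since Θ moves every point by one, p < q and Θ q < Θ p force Θ p = q; applied to the
-- images under w of the points moved by t, this shows that w inverts exactly one of these reflections.
module Submission where

open import Defs
open import Data.Bool using (Bool; true; false; not; if_then_else_)
open import Data.Fin using (Fin; toℕ; fromℕ<)
open import Data.Fin.Permutation using (permutation)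
open import Data.Fin.Properties using (toℕ-injective; toℕ-fromℕ<; toℕ<n)
open import Data.Integer as ℤ using (ℤ; +_; -[1+_]; _+_; _-_; _*_; -_; ∣_∣; _<_; _≤_)
open import Data.Integer.DivMod using (_%ℕ_; _/ℕ_; n%ℕd<d; a≡a%ℕn+[a/ℕn]*n)
open import Data.Integer.Divisibility.Signed using (divides; ∣ᵤ⇒∣; ∣⇒∣ᵤ)
open import Data.Integer.Properties as ℤₚ hiding (_≟_; _≤?_; _<?_)
open import Algebra.Properties.CommutativeMonoid.Sum ℤₚ.+-0-commutativeMonoid using (sum; sum-permute; sum-cong-≗; ∑-distrib-+)
open import Algebra.Properties.Semiring.Sum ℤₚ.+-*-semiring using (*-distribˡ-sum)
open import Data.Integer.Tactic.RingSolver using (solve-∀)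
open import Data.List using (List; []; _∷_; [_]; _++_; map; reverse; length; upTo; applyUpTo)
open import Data.List.Membership.Propositional using (_∈_)
open import Data.List.Membership.Propositional.Properties using (∈-upTo⁺; ∈-upTo⁻)
open import Data.List.Properties using (length-++; length-reverse; unfold-reverse; map-upTo)
open import Data.List.Relation.Unary.All as All using (All; []; _∷_)
import Data.List.Relation.Unary.All.Properties as Allₚ
open import Data.List.Relation.Unary.AllPairs using ([]; _∷_)
open import Data.List.Relation.Unary.Any using (here; there)
import Data.List.Relation.Unary.Any.Properties as Anyₚ
open import Data.List.Relation.Unary.Unique.Propositional using (Unique)
open import Data.List.Relation.Unary.Unique.Propositional.Properties using (upTo⁺)
open import Data.Nat as ℕ using (ℕ; zero; suc; NonZero; ⌊_/2⌋)
import Data.Nat.Divisibility as ℕ∣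
open import Data.Nat.Induction using (Acc; acc; <-wellFounded)
import Data.Nat.Properties as ℕₚ
import Data.Nat.Tactic.RingSolver as ℕ-Solver
open import Data.Product using (Σ; ∃; _×_; _,_; proj₁; proj₂)
open import Data.Sum using (_⊎_; inj₁; inj₂)
open import Data.Empty using (⊥)
open import Function using (_∘_; id)
open import Relation.Binary using (tri<; tri≈; tri>)
open import Relation.Binary.PropositionalEquality using (_≡_; _≢_; refl; sym; trans; cong; cong₂; subst; subst₂; module ≡-Reasoning)
open import Relation.Nullary using (¬_; Dec; yes; no; does; contradiction)
open import Relation.Nullary.Decidable using (_×-dec_; ¬?; dec-true; dec-false)

-- Length enters only through the exchange condition on words. The length of Θ is whatever remains
-- when the descent stops, and it has to cancel between y and z; so both must reach the same Θ. Here
-- the sum condition is decisive: translation by one conjugates Θ⁺ to Θ⁻, but its total displacement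
-- is not zero. The obstacle to surjectivity is that a given atom w of z need not invert the given
-- t. If t and z t z commute, then t z t = t (z t z) z is symmetric in the two, so both turn z into
-- y, and w selects one of them. Otherwise z exchanges the two residue classes moved by t: z x = t x
-- + m n with m nonzero, and y x = t x - m n. Then t x is the midpoint of z x and y x, which leaves
-- no other candidate. The equation z = t y t does not say which of y and z is longer. This comes in
-- through one fixed v with Θ v = v y, on which every candidate ascends: it gives the relative order
-- of the images under z in the first case, and the sign of m in the second.

-- The ring solver proves identities, not consequences of hypotheses; comparing differences turns a
-- linear consequence of one equation into an identity.
by-difference : ∀ {a b c d : ℤ} → a ≡ b → c - d ≡ a - b → c ≡ d
by-difference {a} {b} {c} {d} refl e = i-j≡0⇒i≡j c d (trans e (i≡j⇒i-j≡0 {a} {a} refl))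

≢⇒<⊎> : ∀ {a b : ℤ} → a ≢ b → a < b ⊎ b < a
≢⇒<⊎> {a} {b} a≢b with <-cmp a b
... | tri< a<b _ _ = inj₁ a<b
... | tri≈ _ a≡b _ = contradiction a≡b a≢b
... | tri> _ _ b<a = inj₂ b<a

-- Maps that move every point by at most one

Near : Map → Set
Near σ = ∀ x → (σ x ≤ ℤ.suc x) × (x ≤ ℤ.suc (σ x))

-- The chain `σ p` ≤ p + 1 ≤ q ≤ `σ q` + 1 ≤ `σ p` closes up. It serves for simple reflections as
-- well as for Θ.
near-inversion : ∀ {σ} → Near σ → ∀ {p q} → p < q → σ q < σ p → σ p ≡ q
near-inversion near {p} {q} p<q σq<σp =
  ≤-antisym (≤-trans (proj₁ (near p)) (i<j⇒suc[i]≤j p<q))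
            (≤-trans (proj₂ (near q)) (i<j⇒suc[i]≤j σq<σp))

step⇒near : ∀ {σ} → (∀ x → σ x ≡ x + + 1 ⊎ σ x ≡ x - + 1 ⊎ σ x ≡ x) → Near σ
step⇒near {σ} step x with σ x | step x
... | _ | inj₁ refl = ≤-reflexive (up x) , ≤-trans (i≤suc[i] x) (≤-trans (≤-reflexive (sym (up x))) (i≤suc[i] _))
  where
  up : ∀ x → x + + 1 ≡ + 1 + x
  up = solve-∀
... | _ | inj₂ (inj₁ refl) = ≤-trans (pred x) (i≤suc[i] x) , ≤-reflexive (back x)
  where
  back : ∀ x → x ≡ + 1 + (x - + 1)
  back = solve-∀
  pred : ∀ x → x - + 1 ≤ x
  pred x = ≤-trans (i≤suc[i] _) (≤-reflexive (sym (back x)))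
... | _ | inj₂ (inj₂ refl) = i≤suc[i] x , i≤suc[i] x

involution-injective : ∀ (f : Map) → (∀ x → f (f x) ≡ x) → ∀ {x y} → f x ≡ f y → x ≡ y
involution-injective f ff {x} {y} e = trans (sym (ff x)) (trans (cong f e) (ff y))

-- Congruence modulo n, and an intrinsic description of reflections

module _ (n : ℕ) where

  Shift : Map → Set
  Shift f = ∀ x m → f (x + m * + n) ≡ f x + m * + n

  private
    step-neg : ∀ x k m → x + (- k) * m ≡ (x + (- (+ 1 + k)) * m) + m
    step-neg = solve-∀
    step-pos : ∀ x k m → x + (+ 1 + k) * m ≡ (x + k * m) + m
    step-pos = solve-∀
    plus-zero : ∀ x m → x + + 0 * m ≡ x
    plus-zero = solve-∀
    cancel : ∀ a b c → a + c ≡ b + c → a ≡ b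
    cancel a b c e = by-difference e (lem a b c)
      where
      lem : ∀ a b c → a - b ≡ (a + c) - (b + c)
      lem = solve-∀

  shift-by-period : ∀ f → (∀ x → f (x + + n) ≡ f x + + n) → Shift f
  shift-by-period f per x (+ zero) = trans (cong f (plus-zero x (+ n))) (sym (plus-zero (f x) (+ n)))
  shift-by-period f per x (+ suc k) = begin
    f (x + (+ 1 + + k) * + n)     ≡⟨ cong f (step-pos x (+ k) (+ n)) ⟩
    f ((x + + k * + n) + + n)     ≡⟨ per _ ⟩
    f (x + + k * + n) + + n       ≡⟨ cong (_+ + n) (shift-by-period f per x (+ k)) ⟩
    (f x + + k * + n) + + n       ≡⟨ step-pos (f x) (+ k) (+ n) ⟨
    f x + (+ 1 + + k) * + n       ∎
    where open ≡-Reasoning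
  shift-by-period f per x -[1+ k ] = cancel _ _ (+ n) (begin
    f (x + -[1+ k ] * + n) + + n        ≡⟨ per _ ⟨
    f ((x + -[1+ k ] * + n) + + n)      ≡⟨ cong f (step-neg x (+ k) (+ n)) ⟨
    f (x + (- (+ k)) * + n)             ≡⟨ earlier k ⟩
    f x + (- (+ k)) * + n               ≡⟨ step-neg (f x) (+ k) (+ n) ⟩
    (f x + -[1+ k ] * + n) + + n        ∎)
    where
    open ≡-Reasoning
    earlier : ∀ k → f (x + (- (+ k)) * + n) ≡ f x + (- (+ k)) * + n
    earlier zero    = shift-by-period f per x (+ 0)
    earlier (suc k) = shift-by-period f per x -[1+ k ]

  shift⇒period : ∀ {f} → Shift f → ∀ x → f (x + + n) ≡ f x + + n
  shift⇒period {f} sh x = trans (cong f (one x (+ n))) (trans (sh x (+ 1)) (sym (one (f x) (+ n))))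
    where
    one : ∀ x m → x + m ≡ x + + 1 * m
    one = solve-∀

  shift-∘ : ∀ {f g} → Shift f → Shift g → Shift (f ∘ g)
  shift-∘ {f} shf shg x m = trans (cong f (shg x m)) (shf _ m)

  infix 4 _~_
  -- Unlike `Cong`, this keeps the signed quotient, so that matching on it replaces `a` by a
  -- translate of `b` and a `Shift` map can be evaluated there.
  record _~_ (a b : ℤ) : Set where
    constructor _,_
    field
      multiplier : ℤ
      equation   : a ≡ b + multiplier * + n

  cong⇒~ : ∀ {a b} → Cong n a b → a ~ b
  cong⇒~ {a} {b} c with ∣ᵤ⇒∣ {+ n} {a - b} c
  ... | divides q e = q , by-difference e (lem a b (q * + n))
    where
    lem : ∀ a b c → a - (b + c) ≡ (a - b) - c
    lem = solve-∀

  ~⇒cong : ∀ {a b} → a ~ b → Cong n a b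
  ~⇒cong {a} {b} (m , e) = ∣⇒∣ᵤ {+ n} {a - b} (divides m (by-difference e (lem a b (m * + n))))
    where
    lem : ∀ a b c → (a - b) - c ≡ a - (b + c)
    lem = solve-∀

  _~?_ : ∀ a b → Dec (a ~ b)
  a ~? b with n ℕ∣.∣? ∣ a - b ∣
  ... | yes c = yes (cong⇒~ c)
  ... | no ¬c = no (¬c ∘ ~⇒cong)

  ~-sym : ∀ {a b} → a ~ b → b ~ a
  ~-sym {a} {b} (m , e) = - m , by-difference (sym e) (lem a b m (+ n))
    where
    lem : ∀ a b m k → b - (a + - m * k) ≡ (b + m * k) - a
    lem = solve-∀

  ~-trans : ∀ {a b c} → a ~ b → b ~ c → a ~ c
  ~-trans {a} {b} {c} (m , refl) (m′ , refl) = m′ + m , lem c m m′ (+ n)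
    where
    lem : ∀ c m m′ k → (c + m′ * k) + m * k ≡ c + (m′ + m) * k
    lem = solve-∀

  ~-image : ∀ f → Shift f → ∀ {a b} → a ~ b → f a ~ f b
  ~-image f sh {a} {b} (m , refl) = m , sh b m

  -- A form of `IsReflection` that names no ordered pair of indices, so that conjugates by `z` are
  -- again of this form. That the two moved classes are distinct follows from `moved`; see
  -- `moved-≁`.
  record Reflection (t : Map) : Set where
    field
      invol : ∀ x → t (t x) ≡ x
      shift : Shift t
      base  : ℤ
      moved : t base ≢ base
      supp  : ∀ x → t x ≡ x ⊎ x ~ base ⊎ x ~ t base

    inj : ∀ {x y} → t x ≡ t y → x ≡ y
    inj = involution-injective t invol

  open Reflection

  reflection-≈ : ∀ {t s} → s ≈ t → Reflection t → Reflection s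
  reflection-≈ {t} {s} e r = record
    { invol = λ x → trans (e (s x)) (trans (cong t (e x)) (invol r x))
    ; shift = λ x m → trans (e _) (trans (shift r x m) (cong (_+ m * + n) (sym (e x))))
    ; base  = base r
    ; moved = λ q → moved r (trans (sym (e _)) q)
    ; supp  = supp′
    }
    where
    supp′ : ∀ x → s x ≡ x ⊎ x ~ base r ⊎ x ~ s (base r)
    supp′ x rewrite e x | e (base r) = supp r x

  reflection-conj : ∀ {t z} → (∀ x → z (z x) ≡ x) → Shift z → Reflection t → Reflection (z ∘ t ∘ z)
  reflection-conj {t} {z} zz shz r = record
    { invol = λ x → trans (cong (z ∘ t) (zz _)) (trans (cong z (invol r _)) (zz x))
    ; shift = shift-∘ {z} {t ∘ z} shz (shift-∘ {t} {z} (shift r) shz)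
    ; base  = z (base r)
    ; moved = λ e → moved r (involution-injective z zz (trans (cong (z ∘ t) (sym (zz _))) e))
    ; supp  = supp′
    }
    where
    from-z : ∀ {x b} → z x ~ b → x ~ z b
    from-z {x} {b} (m , e) = m , trans (sym (zz x)) (trans (cong z e) (shz b m))
    supp′ : ∀ x → z (t (z x)) ≡ x ⊎ x ~ z (base r) ⊎ x ~ z (t (z (z (base r))))
    supp′ x with supp r (z x)
    ... | inj₁ e        = inj₁ (trans (cong z e) (zz x))
    ... | inj₂ (inj₁ c) = inj₂ (inj₁ (from-z c))
    ... | inj₂ (inj₂ c) = inj₂ (inj₂ (subst (λ b → x ~ z (t b)) (sym (zz _)) (from-z c)))

  module _ .{{_ : NonZero n}} where

    private
      instance
        period-nonZero : ℤ.NonZero (+ n)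
        period-nonZero = record { nonZero = ℕ.NonZero.nonZero (ℕ.≢-nonZero (ℕ.≢-nonZero⁻¹ n)) }

    multiple-zero : ∀ m → m * + n ≡ + 0 → m ≡ + 0
    multiple-zero m e = *-cancelʳ-≡ m (+ 0) (+ n) e

    multiple-fixed : ∀ {x m} → x ≡ x + m * + n → m ≡ + 0
    multiple-fixed {x} {m} e = multiple-zero m (by-difference (sym e) (lem x (m * + n)))
      where
      lem : ∀ x a → a - + 0 ≡ (x + a) - x
      lem = solve-∀

    -- An involution commuting with the shift displaces no point by a nonzero multiple of n.
    ~-moved : ∀ {f} → (∀ x → f (f x) ≡ x) → Shift f → ∀ {x} → f x ~ x → f x ≡ x
    ~-moved {f} ff sh {x} (m , e) = trans e (trans (cong (λ k → x + k * + n) m≡0) (plus-zero x (+ n)))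
      where
      twice : x ≡ x + (m + m) * + n
      twice = trans (sym (ff x)) (trans (cong f e) (trans (sh x m) (trans (cong (_+ m * + n) e) (lem x m (+ n)))))
        where
        lem : ∀ x m k → (x + m * k) + m * k ≡ x + (m + m) * k
        lem = solve-∀
      m≡0 : m ≡ + 0
      m≡0 = *-cancelˡ-≡ (+ 2) m (+ 0) (trans (lem m) (multiple-fixed twice))
        where
        lem : ∀ m → + 2 * m ≡ m + m
        lem = solve-∀

    -- Any moved point can take the place of `base`.
    supp-at : ∀ {t} (r : Reflection t) {i} → t i ≢ i → ∀ x → t x ≡ x ⊎ x ~ i ⊎ x ~ t i
    supp-at {t} r {i} ti≢i x with supp r x | supp r i
    ... | inj₁ e | _ = inj₁ e
    ... | _ | inj₁ e = contradiction e ti≢i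
    ... | inj₂ (inj₁ c) | inj₂ (inj₁ d) = inj₂ (inj₁ (~-trans c (~-sym d)))
    ... | inj₂ (inj₂ c) | inj₂ (inj₂ d) = inj₂ (inj₁ (~-trans c (~-sym d)))
    ... | inj₂ (inj₁ c) | inj₂ (inj₂ d) =
      inj₂ (inj₂ (~-trans c (subst (_~ t i) (invol r _) (~-image t (shift r) (~-sym d)))))
    ... | inj₂ (inj₂ c) | inj₂ (inj₁ d) = inj₂ (inj₂ (~-trans c (~-image t (shift r) (~-sym d))))

    moved-≁ : ∀ {t} → Reflection t → ∀ {x} → t x ≢ x → ¬ (t x ~ x)
    moved-≁ r tx≢x c = tx≢x (~-moved (invol r) (shift r) c)

    -- Both sides are determined by their action on one moved point.
    intertwine : ∀ {f g t s} → (∀ x → g (f x) ≡ x) → Shift f → Shift g → Reflection t → Reflection s →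
                 ∀ {x} → t x ≢ x → f (t x) ≡ s (f x) → (f ∘ t) ≈ (s ∘ f)
    intertwine {f} {g} {t} {s} gf shf shg rt rs {x} tx≢x e y with supp-at rt tx≢x y
    ... | inj₂ (inj₁ (m , refl)) = begin
      f (t (x + m * + n))   ≡⟨ cong f (shift rt x m) ⟩
      f (t x + m * + n)     ≡⟨ shf _ m ⟩
      f (t x) + m * + n     ≡⟨ cong (_+ m * + n) e ⟩
      s (f x) + m * + n     ≡⟨ shift rs _ m ⟨
      s (f x + m * + n)     ≡⟨ cong s (shf x m) ⟨
      s (f (x + m * + n))   ∎
      where open ≡-Reasoning
    ... | inj₂ (inj₂ (m , refl)) = begin
      f (t (t x + m * + n))     ≡⟨ cong f (shift rt _ m) ⟩
      f (t (t x) + m * + n)     ≡⟨ cong (λ a → f (a + m * + n)) (invol rt x) ⟩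
      f (x + m * + n)           ≡⟨ shf x m ⟩
      f x + m * + n             ≡⟨ cong (_+ m * + n) (invol rs _) ⟨
      s (s (f x)) + m * + n     ≡⟨ shift rs _ m ⟨
      s (s (f x) + m * + n)     ≡⟨ cong (λ a → s (a + m * + n)) e ⟨
      s (f (t x) + m * + n)     ≡⟨ cong s (shf _ m) ⟨
      s (f (t x + m * + n))     ∎
      where open ≡-Reasoning
    -- If `s` moved `f y`, applying `g` would put `y` in the class of `x` or of `t x`, and `t` moves
    -- both classes.
    ... | inj₁ ty≡y with supp-at rs {f x} (λ q → tx≢x (trans (sym (gf _)) (trans (cong g (trans e q)) (gf x)))) (f y)
    ...   | inj₁ q = trans (cong f ty≡y) (sym q)
    ...   | inj₂ (inj₁ c) = contradiction (moved-class (subst₂ _~_ (gf y) (gf x) (~-image g shg c))) (λ q → q ty≡y)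
      where
      moved-class : y ~ x → t y ≢ y
      moved-class (m , refl) q = tx≢x (cancel _ _ (m * + n) (trans (sym (shift rt x m)) q))
    ...   | inj₂ (inj₂ c) = contradiction (moved-class (subst₂ _~_ (gf y) (trans (cong g (sym e)) (gf _)) (~-image g shg c))) (λ q → q ty≡y)
      where
      moved-class : y ~ t x → t y ≢ y
      moved-class (m , refl) q = tx≢x (inj rt (cancel _ _ (m * + n) (trans (sym (shift rt (t x) m)) q)))

    private
      if-yes : ∀ {P : Set} {A : Set} (d : Dec P) {a b : A} → P → (if does d then a else b) ≡ a
      if-yes d p = cong (if_then _ else _) (dec-true d p)
      if-no : ∀ {P : Set} {A : Set} (d : Dec P) {a b : A} → ¬ P → (if does d then a else b) ≡ b
      if-no d p = cong (if_then _ else _) (dec-false d p)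

    refl-t-at-i : ∀ i j x → x ~ i → refl-t n i j x ≡ x + (j - i)
    refl-t-at-i i j x c = if-yes (n ℕ∣.∣? ∣ x - i ∣) (~⇒cong c)

    refl-t-at-j : ∀ i j x → ¬ (x ~ i) → x ~ j → refl-t n i j x ≡ x - (j - i)
    refl-t-at-j i j x ¬c c = trans (if-no (n ℕ∣.∣? ∣ x - i ∣) (¬c ∘ cong⇒~)) (if-yes (n ℕ∣.∣? ∣ x - j ∣) (~⇒cong c))

    refl-t-fixed : ∀ i j x → ¬ (x ~ i) → ¬ (x ~ j) → refl-t n i j x ≡ x
    refl-t-fixed i j x ¬c ¬d = trans (if-no (n ℕ∣.∣? ∣ x - i ∣) (¬c ∘ cong⇒~)) (if-no (n ℕ∣.∣? ∣ x - j ∣) (¬d ∘ cong⇒~))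

    refl-t-i : ∀ i j m → refl-t n i j (i + m * + n) ≡ j + m * + n
    refl-t-i i j m = trans (refl-t-at-i i j _ (m , refl)) (lem i j (m * + n))
      where
      lem : ∀ i j a → (i + a) + (j - i) ≡ j + a
      lem = solve-∀

    refl-t-j : ∀ i j → ¬ (j ~ i) → ∀ m → refl-t n i j (j + m * + n) ≡ i + m * + n
    refl-t-j i j j≁i m = trans (refl-t-at-j i j _ (λ c → j≁i (~-trans (~-sym (m , refl)) c)) (m , refl)) (lem i j (m * + n))
      where
      lem : ∀ i j a → (j + a) - (j - i) ≡ i + a
      lem = solve-∀

    refl-t-reflection : ∀ i j → ¬ (j ~ i) → Reflection (refl-t n i j)
    refl-t-reflection i j j≁i = record
      { invol = invol′
      ; shift = shift′
      ; base  = i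
      ; moved = λ e → j≁i (subst (_~ i) (trans (sym e) at-i) (+ 0 , sym (plus-zero i (+ n))))
      ; supp  = supp′
      }
      where
      T : Map
      T = refl-t n i j
      at-i : T i ≡ j
      at-i = trans (cong T (sym (plus-zero i (+ n)))) (trans (refl-t-i i j (+ 0)) (plus-zero j (+ n)))
      assoc : ∀ x a b k → (x + a * k) + b * k ≡ x + (a + b) * k
      assoc = solve-∀
      invol′ : ∀ x → T (T x) ≡ x
      invol′ x with x ~? i | x ~? j
      ... | yes (m , refl) | _ = trans (cong T (refl-t-i i j m)) (refl-t-j i j j≁i m)
      ... | no _ | yes (m , refl) = trans (cong T (refl-t-j i j j≁i m)) (refl-t-i i j m)
      ... | no ¬c | no ¬d = trans (cong T (refl-t-fixed i j x ¬c ¬d)) (refl-t-fixed i j x ¬c ¬d)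
      shift′ : Shift T
      shift′ x a with x ~? i | x ~? j
      ... | yes (m , refl) | _ = trans (cong T (assoc i m a (+ n))) (trans (refl-t-i i j (m + a))
              (sym (trans (cong (_+ a * + n) (refl-t-i i j m)) (assoc j m a (+ n)))))
      ... | no _ | yes (m , refl) = trans (cong T (assoc j m a (+ n))) (trans (refl-t-j i j j≁i (m + a))
              (sym (trans (cong (_+ a * + n) (refl-t-j i j j≁i m)) (assoc i m a (+ n)))))
      ... | no ¬c | no ¬d = trans (refl-t-fixed i j _ (λ c → ¬c (~-trans (~-sym (a , refl)) c)) (λ c → ¬d (~-trans (~-sym (a , refl)) c)))
              (cong (_+ a * + n) (sym (refl-t-fixed i j x ¬c ¬d)))
      supp′ : ∀ x → T x ≡ x ⊎ x ~ i ⊎ x ~ T i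
      supp′ x with x ~? i | x ~? j
      ... | yes c | _     = inj₂ (inj₁ c)
      ... | no _  | yes c = inj₂ (inj₂ (subst (x ~_) (sym at-i) c))
      ... | no ¬c | no ¬d = inj₁ (refl-t-fixed i j x ¬c ¬d)

    isReflection⇒reflection : ∀ {t} → IsReflection n t → Reflection t
    isReflection⇒reflection (i , j , _ , ¬c , e) = reflection-≈ e (refl-t-reflection i j (¬c ∘ ~⇒cong))

    reflection≈refl-t : ∀ {t} (r : Reflection t) {i} → t i ≢ i → t ≈ refl-t n i (t i)
    reflection≈refl-t {t} r {i} ti≢i x with supp-at r ti≢i x
    ... | inj₂ (inj₁ (m , refl)) = trans (shift r i m) (sym (refl-t-i i (t i) m))
    ... | inj₂ (inj₂ (m , refl)) = trans (shift r _ m) (trans (cong (_+ m * + n) (invol r i))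
            (sym (refl-t-j i (t i) (moved-≁ r ti≢i) m)))
    ... | inj₁ e with x ~? i | x ~? t i
    ...   | yes (m , refl) | _ = trans (shift r i m) (sym (refl-t-i i (t i) m))
    ...   | no _ | yes (m , refl) = trans (shift r _ m) (trans (cong (_+ m * + n) (invol r i))
            (sym (refl-t-j i (t i) (moved-≁ r ti≢i) m)))
    ...   | no ¬c | no ¬d = trans e (sym (refl-t-fixed i (t i) x ¬c ¬d))

    ascending-point : ∀ {t} → Reflection t → Σ ℤ λ x → x < t x
    ascending-point {t} r with ≢⇒<⊎> (moved r)
    ... | inj₂ b<tb = base r , b<tb
    ... | inj₁ tb<b = t (base r) , subst (t (base r) <_) (sym (invol r _)) tb<b

    reflection⇒isReflection : ∀ {t} → Reflection t → IsReflection n t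
    reflection⇒isReflection {t} r with ascending-point r
    ... | i , i<ti = i , t i , i<ti , (λ c → moved-≁ r ti≢i (cong⇒~ c)) , reflection≈refl-t r ti≢i
      where
      ti≢i : t i ≢ i
      ti≢i e = <⇒≢ i<ti (sym e)

-- Words, length and the exchange condition

≈-sym : ∀ {f g} → f ≈ g → g ≈ f
≈-sym e x = sym (e x)

≈-trans : ∀ {f g h} → f ≈ g → g ≈ h → f ≈ h
≈-trans e e′ x = trans (e x) (e′ x)

HasWord : ℕ → Map → ℕ → Set
HasWord n f k = Σ (List ℕ) λ w → All (InRange n) w × length w ≡ k × prod n w ≈ f

hasWord-≈ : ∀ {n f g k} → f ≈ g → HasWord n f k → HasWord n g k
hasWord-≈ e (w , ok , len , p) = w , ok , len , ≈-trans p e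

isLength-≤ : ∀ {n f k m} → IsLength n f k → HasWord n f m → k ℕ.≤ m
isLength-≤ (_ , lower) (w , ok , refl , p) = lower w ok p

isLength-unique : ∀ {n f k m} → IsLength n f k → IsLength n f m → k ≡ m
isLength-unique ℓ ℓ′ = ℕₚ.≤-antisym (isLength-≤ ℓ (proj₁ ℓ′)) (isLength-≤ ℓ′ (proj₁ ℓ))

isLength-≈ : ∀ {n f g k} → f ≈ g → IsLength n f k → IsLength n g k
isLength-≈ e (hw , lower) = hasWord-≈ e hw , λ w ok p → lower w ok (≈-trans p (≈-sym e))

prod-++ : ∀ n u v → prod n (u ++ v) ≈ (prod n u ∘ prod n v)
prod-++ n []      v x = refl
prod-++ n (i ∷ u) v x = cong (gen n i) (prod-++ n u v x)

Descends Ascends : Map → Map → Set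
Descends t f = ∀ x → x < t x → f (t x) < f x
Ascends  t f = ∀ x → x < t x → f x < f (t x)

module _ (n : ℕ) .{{_ : NonZero n}} where

  open Reflection

  private
    +-<-shift : ∀ {a b c} → a < b → a + c < b + c
    +-<-shift {c = c} = +-monoˡ-< c
    +-<-unshift : ∀ {a b c} → a + c < b + c → a < b
    +-<-unshift {a} {b} {c} lt = subst₂ _<_ (lem a c) (lem b c) (+-monoˡ-< (- c) lt)
      where
      lem : ∀ a c → (a + c) + - c ≡ a
      lem = solve-∀

  -- On the class of `t x` the reflection lowers every point, so only the class of `x` can rise.
  -- Hence one rising point decides between `Ascends` and `Descends` for a map that commutes with
  -- the shift.
  ascending-class : ∀ {t} → Reflection n t → ∀ {x} → x < t x → ∀ y → y < t y → _~_ n y x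
  ascending-class {t} rt {x} x<tx y y<ty with supp-at n rt (λ e → <⇒≢ x<tx (sym e)) y
  ... | inj₁ e        = contradiction (sym e) (<⇒≢ y<ty)
  ... | inj₂ (inj₁ c) = c
  ... | inj₂ (inj₂ (m , refl)) = contradiction x<tx (<-asym (+-<-unshift {c = m * + n}
          (subst (t x + m * + n <_) (trans (shift rt _ m) (cong (_+ m * + n) (invol rt x))) y<ty)))

  descends-at : ∀ {t f} → Reflection n t → Shift n f → ∀ {x} → x < t x → f (t x) < f x → Descends t f
  descends-at {t} {f} rt shf {x} x<tx desc y y<ty with ascending-class rt x<tx y y<ty
  ... | m , refl = subst₂ _<_ (sym (trans (cong f (shift rt x m)) (shf _ m))) (sym (shf x m)) (+-<-shift {c = m * + n} desc)

  ascends⊎descends : ∀ {t f} → Reflection n t → Shift n f → (∀ {x y} → f x ≡ f y → x ≡ y) → Ascends t f ⊎ Descends t f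
  ascends⊎descends {t} {f} rt shf injf with ascending-point n rt
  ... | x , x<tx with ≢⇒<⊎> (λ e → <⇒≢ x<tx (injf e))
  ...   | inj₂ desc = inj₂ (descends-at rt shf x<tx desc)
  ...   | inj₁ asc  = inj₁ asc′
    where
    asc′ : Ascends t f
    asc′ y y<ty with ascending-class rt x<tx y y<ty
    ... | m , refl = subst₂ _<_ (sym (shf x m)) (sym (trans (cong f (shift rt x m)) (shf _ m))) (+-<-shift {c = m * + n} asc)

module Words (n : ℕ) (2≤n : 2 ℕ.≤ n) where

  instance
    n-nonZero : NonZero n
    n-nonZero = ℕ.>-nonZero (ℕₚ.≤-trans (ℕ.s≤s ℕ.z≤n) 2≤n)

  open Reflection

  suc≁ : ∀ x → ¬ (_~_ n (+ 1 + x) x)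
  suc≁ x (m , e) = ℕₚ.<⇒≢ 2≤n (sym (ℕ∣.∣1⇒≡1 (∣⇒∣ᵤ {+ n} {+ 1} (divides m (by-difference e (lem x (m * + n)))))))
    where
    lem : ∀ x a → + 1 - a ≡ (+ 1 + x) - (x + a)
    lem = solve-∀

  gen≈refl-t : ∀ i → gen n i ≈ refl-t n (+ i) (+ suc i)
  gen≈refl-t i x = cong (λ d → if congᵇ n x (+ i) then x + d else if congᵇ n x (+ suc i) then x - d else x) (lem (+ i))
    where
    lem : ∀ i → + 1 ≡ (+ 1 + i) - i
    lem = solve-∀

  gen-isRefl : ∀ i → IsReflection n (gen n i)
  gen-isRefl i = + i , + suc i , ℤ.+<+ (ℕₚ.n<1+n i) , (λ c → suc≁ (+ i) (cong⇒~ n c)) , gen≈refl-t i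

  gen-refl : ∀ i → Reflection n (gen n i)
  gen-refl i = isReflection⇒reflection n (gen-isRefl i)

  gen-i : ∀ i m → gen n i (+ i + m * + n) ≡ + suc i + m * + n
  gen-i i m = trans (gen≈refl-t i _) (refl-t-i n (+ i) (+ suc i) m)

  gen-suc : ∀ i m → gen n i (+ suc i + m * + n) ≡ + i + m * + n
  gen-suc i m = trans (gen≈refl-t i _) (refl-t-j n (+ i) (+ suc i) (suc≁ (+ i)) m)

  gen-fixed : ∀ i x → ¬ (_~_ n x (+ i)) → ¬ (_~_ n x (+ suc i)) → gen n i x ≡ x
  gen-fixed i x ¬c ¬d = trans (gen≈refl-t i x) (refl-t-fixed n (+ i) (+ suc i) x ¬c ¬d)

  gen-at : ∀ i → gen n i (+ i) ≡ + suc i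
  gen-at i = trans (cong (gen n i) (sym (lem (+ i) (+ n)))) (trans (gen-i i (+ 0)) (lem (+ suc i) (+ n)))
    where
    lem : ∀ x m → x + + 0 * m ≡ x
    lem = solve-∀

  gen-near : ∀ i → Near (gen n i)
  gen-near i = step⇒near step
    where
    step : ∀ x → gen n i x ≡ x + + 1 ⊎ gen n i x ≡ x - + 1 ⊎ gen n i x ≡ x
    step x with congᵇ n x (+ i) | congᵇ n x (+ suc i)
    ... | true  | _     = inj₁ refl
    ... | false | true  = inj₂ (inj₁ refl)
    ... | false | false = inj₂ (inj₂ refl)

  prod-shift : ∀ w → Shift n (prod n w)
  prod-shift []      x m = refl
  prod-shift (i ∷ w) = shift-∘ n {gen n i} {prod n w} (shift (gen-refl i)) (prod-shift w)

  prod-reverse : ∀ w x → prod n (reverse w) (prod n w x) ≡ x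
  prod-reverse []      x = refl
  prod-reverse (i ∷ w) x = begin
    prod n (reverse (i ∷ w)) (gen n i (prod n w x))     ≡⟨ cong (λ u → prod n u (gen n i (prod n w x))) (unfold-reverse i w) ⟩
    prod n (reverse w ++ [ i ]) (gen n i (prod n w x))  ≡⟨ prod-++ n (reverse w) [ i ] _ ⟩
    prod n (reverse w) (gen n i (gen n i (prod n w x))) ≡⟨ cong (prod n (reverse w)) (invol (gen-refl i) _) ⟩
    prod n (reverse w) (prod n w x)                     ≡⟨ prod-reverse w x ⟩
    x                                                   ∎
    where open ≡-Reasoning

  prod-injective : ∀ w {x y} → prod n w x ≡ prod n w y → x ≡ y
  prod-injective w e = trans (sym (prod-reverse w _)) (trans (cong (prod n (reverse w)) e) (prod-reverse w _))

  hasWord-∘ : ∀ {f g k m} → HasWord n f k → HasWord n g m → HasWord n (f ∘ g) (k ℕ.+ m)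
  hasWord-∘ {f} (u , oku , refl , pu) (v , okv , refl , pv) =
    u ++ v , Allₚ.++⁺ oku okv , length-++ u , λ x → trans (prod-++ n u v x) (trans (pu _) (cong f (pv x)))

  hasWord-inverse : ∀ {f g k} → (∀ x → f (g x) ≡ x) → HasWord n f k → HasWord n g k
  hasWord-inverse {f} {g} fg (w , ok , refl , p) =
    reverse w , Allₚ.anti-mono Anyₚ.reverse⁻ ok , length-reverse w ,
    λ x → trans (cong (prod n (reverse w)) (sym (trans (p (g x)) (fg x)))) (prod-reverse w (g x))

  gen-hasWord : ∀ {i} → InRange n i → HasWord n (gen n i) 1
  gen-hasWord ok = _ , ok ∷ [] , refl , λ x → refl

  hasWord-shift : ∀ {f k} → HasWord n f k → Shift n f
  hasWord-shift {f} (w , _ , _ , p) x m = trans (sym (p _)) (trans (prod-shift w x m) (cong (_+ m * + n) (p x)))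

  -- The letter to delete is the one at which the images of x and t x cross.
  prod-exchange : ∀ {t} → Reflection n t → ∀ {x} → x < t x → ∀ w → All (InRange n) w →
                  prod n w (t x) < prod n w x → ∃ λ k → length w ≡ suc k × HasWord n (prod n w ∘ t) k
  prod-exchange rt x<tx [] ok desc = contradiction x<tx (<-asym desc)
  prod-exchange {t} rt {x} x<tx (i ∷ w) (iok ∷ ok) desc with ≢⇒<⊎> (λ e → <⇒≢ x<tx (prod-injective w e))
  ... | inj₂ below with prod-exchange rt x<tx w ok below
  ...   | k , len , hw = suc k , cong suc len , hasWord-∘ (gen-hasWord iok) hw
  -- The letter `i` reverses two values that `w` leaves in order, so by `near-inversion` it
  -- exchanges them. Thus `prod n w ∘ t` equals `gen n i ∘ prod n w`, and the two copies of
  -- `gen n i` cancel.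
  prod-exchange {t} rt {x} x<tx (i ∷ w) (iok ∷ ok) desc | inj₁ above =
    length w , refl , w , ok , refl , λ y →
      trans (sym (invol (gen-refl i) _))
            (cong (gen n i) (sym (intertwine n {prod n w} {prod n (reverse w)} (prod-reverse w) (prod-shift w) (prod-shift (reverse w))
                               rt (gen-refl i) (λ e → <⇒≢ x<tx (sym e)) (sym (near-inversion (gen-near i) above desc)) y)))

  -- The strong exchange condition, for words that need not be reduced. It is the only bridge from
  -- inversions to length.
  exchange : ∀ {t f k} → Reflection n t → ∀ {x} → x < t x → f (t x) < f x → HasWord n f k →
             ∃ λ m → k ≡ suc m × HasWord n (f ∘ t) m
  exchange {t} {f} rt {x} x<tx desc (w , ok , refl , p) with prod-exchange rt x<tx w ok (subst₂ _<_ (sym (p _)) (sym (p _)) desc)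
  ... | m , len , hw = m , len , hasWord-≈ (λ y → p (t y)) hw

  hasWord-injective : ∀ {f k} → HasWord n f k → ∀ {x y} → f x ≡ f y → x ≡ y
  hasWord-injective (w , _ , _ , p) e = prod-injective w (trans (p _) (trans e (sym (p _))))

-- Sums over one period, and the group of affine permutations

module _ (n : ℕ) where

  window : Map → ℤ
  window g = sum {n} (λ i → g (+ toℕ i))

  window-cong : ∀ {f g} → f ≈ g → window f ≡ window g
  window-cong e = sum-cong-≗ {n} (λ i → e _)

  window-+ : ∀ f g → window (λ x → f x + g x) ≡ window f + window g
  window-+ f g = ∑-distrib-+ {n} _ _

  window-* : ∀ c f → window (λ x → c * f x) ≡ c * window f
  window-* c f = sym (*-distribˡ-sum {n} c (λ i → f (+ toℕ i)))

  window-neg : ∀ f → window (λ x → - f x) ≡ - window f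
  window-neg f = trans (window-cong (λ x → sym (-1*i≡-i (f x)))) (trans (window-* (- + 1) f) (-1*i≡-i _))

window-const : ∀ n c → window n (λ _ → c) ≡ + n * c
window-const zero    c = sym (*-zeroˡ c)
window-const (suc n) c = trans (cong (λ a → c + a) (window-const n c)) (sym (suc-* (+ n) c))

window-list : ∀ n (f : Map) → sumℤ (map (λ k → f (+ suc k)) (upTo n)) ≡ window n (λ x → f (+ 1 + x))
window-list n f = trans (cong sumℤ (map-upTo _ n)) (go n (λ k → f (+ suc k)))
  where
  go : ∀ n (a : ℕ → ℤ) → sumℤ (applyUpTo a n) ≡ sum {n} (λ i → a (toℕ i))
  go zero    a = refl
  go (suc n) a = cong (λ s → a 0 + s) (go n (a ∘ suc))

shift-inverse : ∀ n {f g} → (∀ x → g (f x) ≡ x) → (∀ x → f (g x) ≡ x) → Shift n f → Shift n g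
shift-inverse n {f} {g} gf fg sh x m =
  trans (cong (λ a → g (a + m * + n)) (sym (fg x))) (trans (cong g (sym (sh _ m))) (gf _))

module _ (n : ℕ) .{{_ : NonZero n}} where

  private
    too-big : ∀ {a b} k → a ℕ.< n → + a ≢ + b + + suc k * + n
    too-big {a} {b} k a<n e = ℕₚ.<⇒≱ a<n (subst (n ℕ.≤_) (sym a≡) (ℕₚ.≤-trans (ℕₚ.m≤m+n n (k ℕ.* n)) (ℕₚ.m≤n+m _ b)))
      where
      a≡ : a ≡ b ℕ.+ suc k ℕ.* n
      a≡ = +-injective (trans e (cong (λ c → + b + c) (sym (pos-* (suc k) n))))

  remainder-unique : ∀ {a b} → a ℕ.< n → b ℕ.< n → _~_ n (+ a) (+ b) → a ≡ b
  remainder-unique {a} {b} a<n b<n (+ zero , e) = +-injective (trans e (trans (cong (λ c → + b + c) (*-zeroˡ (+ n))) (+-identityʳ (+ b))))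
  remainder-unique a<n b<n (+ suc k , e) = contradiction e (too-big k a<n)
  remainder-unique {a} {b} a<n b<n (-[1+ k ] , e) =
    contradiction (_~_.equation (~-sym n {+ a} {+ b} (-[1+ k ] , e))) (too-big k b<n)

  remainder : ∀ x → Σ ℕ λ k → k ℕ.< n × _~_ n x (+ k)
  remainder x = x %ℕ n , n%ℕd<d x n , (x /ℕ n , a≡a%ℕn+[a/ℕn]*n x n)

  private
    residue : ℤ → Fin n
    residue x = fromℕ< (n%ℕd<d x n)

    residue-~ : ∀ x → _~_ n (+ toℕ (residue x)) x
    residue-~ x = ~-sym n (x /ℕ n , trans (a≡a%ℕn+[a/ℕn]*n x n) (cong (λ k → + k + (x /ℕ n) * + n) (sym (toℕ-fromℕ< (n%ℕd<d x n)))))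

    residue-unique : ∀ {x} i → _~_ n x (+ toℕ i) → residue x ≡ i
    residue-unique {x} i c = toℕ-injective (remainder-unique (toℕ<n (residue x)) (toℕ<n i) (~-trans n (residue-~ x) c))

  -- `u` permutes the residues modulo n, and a periodic `g` sees only residues.
  window-reindex : ∀ {g u v : Map} → (∀ x m → g (x + m * + n) ≡ g x) →
                   (∀ x → v (u x) ≡ x) → (∀ x → u (v x) ≡ x) → Shift n u → Shift n v →
                   window n (g ∘ u) ≡ window n g
  window-reindex {g} {u} {v} per vu uv shu shv = begin
    window n (g ∘ u)                             ≡⟨ sum-cong-≗ {n} (λ i → per-~ (~-sym n (residue-~ (u (+ toℕ i))))) ⟩
    sum {n} (λ i → g (+ toℕ (residue (u (+ toℕ i)))))  ≡⟨ sum-permute {n} {n} (λ i → g (+ toℕ i)) (permutation {n} {n} (λ i → residue (u (+ toℕ i))) (λ i → residue (v (+ toℕ i))) (back u v shu uv) (back v u shv vu)) ⟨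
    window n g                                   ∎
    where
    open ≡-Reasoning
    per-~ : ∀ {x y} → _~_ n x y → g x ≡ g y
    per-~ (m , refl) = per _ m
    back : ∀ u v → Shift n u → (∀ x → u (v x) ≡ x) → ∀ i → residue (u (+ toℕ (residue (v (+ toℕ i))))) ≡ i
    back u v shu uv i = residue-unique i (subst (_~_ n _) (uv _) (~-image n u shu (residue-~ (v (+ toℕ i)))))

  displacement : Map → Map
  displacement f x = f x - x

  -- The sum condition becomes vanishing total displacement: unlike `f`, its displacement is
  -- periodic, so the sum can be reindexed by `window-reindex`. This yields closure under
  -- composition and inverses.
  record Affine (f : Map) : Set where
    field
      inverse  : Map
      inverseˡ : ∀ x → inverse (f x) ≡ x
      inverseʳ : ∀ x → f (inverse x) ≡ x
      shift    : Shift n f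
      balanced : window n (displacement f) ≡ + 0

    injective : ∀ {x y} → f x ≡ f y → x ≡ y
    injective e = trans (sym (inverseˡ _)) (trans (cong inverse e) (inverseˡ _))

    inverse-shift : Shift n inverse
    inverse-shift = shift-inverse n {f} {inverse} inverseˡ inverseʳ shift

  open Affine

  displacement-periodic : ∀ f → Shift n f → ∀ x m → displacement f (x + m * + n) ≡ displacement f x
  displacement-periodic f sh x m = trans (cong (_- (x + m * + n)) (sh x m)) (lem (f x) x (m * + n))
    where
    lem : ∀ a b c → (a + c) - (b + c) ≡ a - b
    lem = solve-∀

  window-suc : ∀ f → Shift n f → window n (λ x → displacement f (+ 1 + x)) ≡ window n (displacement f)
  window-suc f sh = window-reindex {u = λ x → + 1 + x} {v = λ x → x - + 1} (displacement-periodic f sh)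
                    lem₁ lem₂ (λ x m → lem₃ x (m * + n)) (λ x m → lem₄ x (m * + n))
    where
    lem₁ : ∀ x → (+ 1 + x) - + 1 ≡ x
    lem₁ = solve-∀
    lem₂ : ∀ x → + 1 + (x - + 1) ≡ x
    lem₂ = solve-∀
    lem₃ : ∀ x a → + 1 + (x + a) ≡ (+ 1 + x) + a
    lem₃ = solve-∀
    lem₄ : ∀ x a → (x + a) - + 1 ≡ (x - + 1) + a
    lem₄ = solve-∀

  private
    window-split : ∀ f → window n (λ x → f (+ 1 + x)) ≡ window n (λ x → displacement f (+ 1 + x)) + window n ℤ.suc
    window-split f = trans (window-cong n (λ x → lem (f (+ 1 + x)) (+ 1 + x))) (window-+ n (λ x → displacement f (+ 1 + x)) ℤ.suc)
      where
      lem : ∀ a b → a ≡ (a - b) + b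
      lem = solve-∀

  affPerm⇒affine : ∀ {f} → IsAffPerm n f → Affine f
  affPerm⇒affine {f} ((g , gf) , per , total) = record
    { inverse  = g
    ; inverseˡ = λ x → proj₁ (gf x)
    ; inverseʳ = λ x → proj₂ (gf x)
    ; shift    = sh
    ; balanced = trans (sym (window-suc f sh)) (by-difference
        (trans (sym (window-split f)) (trans (sym (window-list n f)) (trans total (window-list n id))))
        (lem (window n (λ x → displacement f (+ 1 + x))) (window n ℤ.suc)))
    }
    where
    sh : Shift n f
    sh = shift-by-period n f per
    lem : ∀ a b → a - + 0 ≡ (a + b) - b
    lem = solve-∀

  affine⇒affPerm : ∀ {f} → Affine f → IsAffPerm n f
  affine⇒affPerm {f} a = (inverse a , λ x → inverseˡ a x , inverseʳ a x) , shift⇒period n {f} (shift a) ,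
    trans (window-list n f) (trans (window-split f) (trans (cong (_+ window n ℤ.suc) (trans (window-suc f (shift a)) (balanced a)))
      (trans (+-identityˡ _) (sym (window-list n id)))))

  affine-id : Affine id
  affine-id = record
    { inverse = id ; inverseˡ = λ _ → refl ; inverseʳ = λ _ → refl ; shift = λ _ _ → refl
    ; balanced = trans (window-cong n {displacement id} lem) (trans (window-const n (+ 0)) (*-zeroʳ (+ n)))
    }
    where
    lem : ∀ x → x - x ≡ + 0
    lem = solve-∀

  affine-∘ : ∀ {f g} → Affine f → Affine g → Affine (f ∘ g)
  affine-∘ {f} {g} a b = record
    { inverse  = inverse b ∘ inverse a
    ; inverseˡ = λ x → trans (cong (inverse b) (inverseˡ a _)) (inverseˡ b x)
    ; inverseʳ = λ x → trans (cong f (inverseʳ b _)) (inverseʳ a x)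
    ; shift    = shift-∘ n {f} {g} (shift a) (shift b)
    ; balanced = begin
        window n (displacement (f ∘ g))                              ≡⟨ window-cong n (λ x → lem (f (g x)) (g x) x) ⟩
        window n (λ x → displacement f (g x) + displacement g x)     ≡⟨ window-+ n (displacement f ∘ g) (displacement g) ⟩
        window n (displacement f ∘ g) + window n (displacement g)    ≡⟨ cong₂ _+_ (window-reindex {u = g} {v = inverse b} (displacement-periodic f (shift a)) (inverseˡ b) (inverseʳ b) (shift b) (inverse-shift b)) (balanced b) ⟩
        window n (displacement f) + + 0                              ≡⟨ cong (_+ + 0) (balanced a) ⟩
        + 0                                                          ∎
    }
    where
    open ≡-Reasoning
    lem : ∀ a b c → a - c ≡ (a - b) + (b - c)
    lem = solve-∀

  affine-inverse : ∀ {f} (a : Affine f) → Affine (inverse a)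
  affine-inverse {f} a = record
    { inverse  = f
    ; inverseˡ = inverseʳ a
    ; inverseʳ = inverseˡ a
    ; shift    = inverse-shift a
    ; balanced = begin
        window n (displacement (inverse a))           ≡⟨ window-reindex {u = f} {v = inverse a} (displacement-periodic (inverse a) (inverse-shift a)) (inverseˡ a) (inverseʳ a) (shift a) (inverse-shift a) ⟨
        window n (displacement (inverse a) ∘ f)       ≡⟨ window-cong n (λ x → trans (cong (_- f x) (inverseˡ a x)) (lem (f x) x)) ⟩
        window n (λ x → - displacement f x)           ≡⟨ window-neg n (displacement f) ⟩
        - window n (displacement f)                   ≡⟨ cong -_ (balanced a) ⟩
        + 0                                           ∎
    }
    where
    open ≡-Reasoning
    lem : ∀ a b → b - a ≡ - (a - b)
    lem = solve-∀

  -- The displacement of an involution is odd under it, so it sums to zero.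
  affine-reflection : ∀ {t} → Reflection n t → Affine t
  affine-reflection {t} r = record
    { inverse = t ; inverseˡ = invol ; inverseʳ = invol ; shift = sh ; balanced = self-negative (begin
        window n (displacement t)             ≡⟨ window-reindex {u = t} {v = t} (displacement-periodic t sh) invol invol sh sh ⟨
        window n (displacement t ∘ t)         ≡⟨ window-cong n (λ x → trans (cong (_- t x) (invol x)) (lem (t x) x)) ⟩
        window n (λ x → - displacement t x)   ≡⟨ window-neg n (displacement t) ⟩
        - window n (displacement t)           ∎)
    }
    where
    open Reflection r using (invol) renaming (shift to sh)
    open ≡-Reasoning
    lem : ∀ a b → b - a ≡ - (a - b)
    lem = solve-∀
    self-negative : ∀ {a} → a ≡ - a → a ≡ + 0
    self-negative {a} e = *-cancelˡ-≡ (+ 2) a (+ 0) (by-difference e (lem′ a))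
      where
      lem′ : ∀ a → + 2 * a - + 0 ≡ a - - a
      lem′ = solve-∀

-- Parity, halves, and displacement sums modulo h

even≢odd : ∀ a b → + 2 * a ≢ + 1 + + 2 * b
even≢odd a b e with remainder-unique 2 {0} {1} (ℕ.s≤s ℕ.z≤n) (ℕ.s≤s (ℕ.s≤s ℕ.z≤n)) (b - a , by-difference e (lem a b))
  where
  lem : ∀ a b → + 0 - (+ 1 + (b - a) * + 2) ≡ + 2 * a - (+ 1 + + 2 * b)
  lem = solve-∀
... | ()

half : ∀ x → Σ ℤ λ u → x ≡ + 2 * u ⊎ x ≡ + 1 + + 2 * u
half x with remainder 2 x
... | 0 , _ , (m , e) = m , inj₁ (trans e (lem m))
  where
  lem : ∀ m → + 0 + m * + 2 ≡ + 2 * m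
  lem = solve-∀
... | 1 , _ , (m , e) = m , inj₂ (trans e (lem m))
  where
  lem : ∀ m → + 1 + m * + 2 ≡ + 1 + + 2 * m
  lem = solve-∀
... | suc (suc k) , ℕ.s≤s (ℕ.s≤s ()) , _

⌊_/2⌋ᶻ : ℤ → ℤ
⌊ x /2⌋ᶻ = proj₁ (half x)

half-unique : ∀ {x a} → x ≡ + 2 * a ⊎ x ≡ + 1 + + 2 * a → ⌊ x /2⌋ᶻ ≡ a
half-unique {x} {a} p with half x | p
... | u , inj₁ e | inj₁ e′ = *-cancelˡ-≡ (+ 2) u a (trans (sym e) e′)
... | u , inj₁ e | inj₂ e′ = contradiction (trans (sym e) e′) (even≢odd u a)
... | u , inj₂ e | inj₁ e′ = contradiction (trans (sym e′) e) (even≢odd a u)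
... | u , inj₂ e | inj₂ e′ = *-cancelˡ-≡ (+ 2) u a (by-difference (trans (sym e) e′) (lem u a))
  where
  lem : ∀ u a → + 2 * u - + 2 * a ≡ (+ 1 + + 2 * u) - (+ 1 + + 2 * a)
  lem = solve-∀

-- Residues modulo h are permuted, so the displacements add up to a multiple of h.
window-displacement-∣ : ∀ h .{{_ : NonZero h}} {u v : Map} → (∀ x → v (u x) ≡ x) → (∀ x → u (v x) ≡ x) →
                        Shift h u → Shift h v → Σ ℤ λ c → window h (λ x → u x - x) ≡ + h * c
window-displacement-∣ h {u} {v} vu uv shu shv = window h (λ x → Q (u x) + - Q x) , (begin
  window h (λ x → u x - x)
    ≡⟨ window-cong h (λ x → split (u x) x) ⟩
  window h (λ x → (R (u x) + - R x) + + h * (Q (u x) + - Q x))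
    ≡⟨ window-+ h (λ x → R (u x) + - R x) (λ x → + h * (Q (u x) + - Q x)) ⟩
  window h (λ x → R (u x) + - R x) + window h (λ x → + h * (Q (u x) + - Q x))
    ≡⟨ cong₂ _+_ (trans (window-+ h (R ∘ u) (-_ ∘ R)) (cong₂ _+_ (window-reindex h {R} {u} {v} periodic vu uv shu shv) (window-neg h R)))
                 (window-* h (+ h) (λ x → Q (u x) + - Q x)) ⟩
  (window h R + - window h R) + + h * window h (λ x → Q (u x) + - Q x)
    ≡⟨ trans (cong (λ a → a + + h * c) (+-inverseʳ (window h R))) (+-identityˡ (+ h * c)) ⟩
  + h * c ∎)
  where
  open ≡-Reasoning
  R Q : Map
  R x = + (x %ℕ h)
  Q x = x /ℕ h
  c : ℤ
  c = window h (λ x → Q (u x) + - Q x)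
  split : ∀ y x → y - x ≡ (R y + - R x) + + h * (Q y + - Q x)
  split y x = trans (cong₂ _-_ (a≡a%ℕn+[a/ℕn]*n y h) (a≡a%ℕn+[a/ℕn]*n x h)) (lem (R y) (Q y) (R x) (Q x) (+ h))
    where
    lem : ∀ r q r′ q′ k → (r + q * k) - (r′ + q′ * k) ≡ (r + - r′) + k * (q + - q′)
    lem = solve-∀
  periodic : ∀ x m → R (x + m * + h) ≡ R x
  periodic x m = cong +_ (remainder-unique h (n%ℕd<d (x + m * + h) h) (n%ℕd<d x h)
    (~-trans h (~-sym h (Q (x + m * + h) , a≡a%ℕn+[a/ℕn]*n (x + m * + h) h))
               (~-trans h (m , refl) (Q x , a≡a%ℕn+[a/ℕn]*n x h))))

window-pairs : ∀ h f → window (h ℕ.* 2) f ≡ window h (λ m → f (+ 2 * m) + f (+ 1 + + 2 * m))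
window-pairs h f = trans (go h (λ k → f (+ k))) (window-cong′ (λ i → cong₂ _+_ (cong f (lem i)) (cong (λ a → f (+ 1 + a)) (lem i))))
  where
  lem : ∀ (i : Fin h) → + (toℕ i ℕ.* 2) ≡ + 2 * + toℕ i
  lem i = trans (pos-* (toℕ i) 2) (*-comm (+ toℕ i) (+ 2))
  window-cong′ : ∀ {a b : Fin h → ℤ} → (∀ i → a i ≡ b i) → sum a ≡ sum b
  window-cong′ = sum-cong-≗ {h}
  go : ∀ h (a : ℕ → ℤ) → sum {h ℕ.* 2} (λ i → a (toℕ i)) ≡ sum {h} (λ i → a (toℕ i ℕ.* 2) + a (suc (toℕ i ℕ.* 2)))
  go zero    a = refl
  go (suc h) a = trans (sym (+-assoc (a 0) (a 1) _)) (cong (λ s → (a 0 + a 1) + s) (go h (a ∘ suc ∘ suc)))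

-- The involutions Θ⁺ and Θ⁻ and why they are not conjugate

offset : Bool → ℕ
offset true  = 1
offset false = 2

-- The two ends of the cycles of Θ, indexed by all integers `u`. The offset is the first letter of
-- the word, 1 for Θ⁺ and 2 for Θ⁻.
lower upper : Bool → Map
lower b u = + offset b + + 2 * u
upper b u = + 1 + lower b u

module Theta (h : ℕ) (2≤n : 2 ℕ.≤ h ℕ.* 2) where

  n : ℕ
  n = h ℕ.* 2

  open Words n 2≤n

  instance
    h-nonZero : NonZero h
    h-nonZero = ℕ.≢-nonZero λ { refl → ℕₚ.<⇒≱ (ℕ.s≤s ℕ.z≤n) 2≤n }

  double-multiple : ∀ q → q * + n ≡ + 2 * (q * + h)
  double-multiple q = trans (cong (q *_) (pos-* h 2)) (lem q (+ h))
    where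
    lem : ∀ q k → q * (k * + 2) ≡ + 2 * (q * k)
    lem = solve-∀

  private
    end : Bool → ℕ → ℕ
    end false i = i
    end true  i = suc i

    end-+ : ∀ ε d i → end ε (d ℕ.+ i) ≡ d ℕ.+ end ε i
    end-+ false d i = refl
    end-+ true  d i = sym (ℕₚ.+-suc d i)

    end-< : ∀ ε {k} → k ℕ.< h → end ε (2 ℕ.* k) ℕ.< n
    end-< ε {k} k<h = ℕₚ.≤-trans (ℕ.s≤s (bound ε)) (subst (ℕ._≤ n) (lem k) (ℕₚ.*-monoˡ-≤ 2 k<h))
      where
      bound : ∀ ε → end ε (2 ℕ.* k) ℕ.≤ suc (2 ℕ.* k)
      bound false = ℕₚ.n≤1+n _
      bound true  = ℕₚ.≤-refl
      lem : ∀ k → suc k ℕ.* 2 ≡ suc (suc (2 ℕ.* k))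
      lem k = cong (suc ∘ suc) (ℕₚ.*-comm k 2)

    end-injective : ∀ ε ε′ {k k′} → end ε (2 ℕ.* k) ≡ end ε′ (2 ℕ.* k′) → k ≡ k′
    end-injective false false {k} {k′} e = ℕₚ.*-cancelˡ-≡ k k′ 2 e
    end-injective true  true  {k} {k′} e = ℕₚ.*-cancelˡ-≡ k k′ 2 (ℕₚ.suc-injective e)
    end-injective false true  {k} {k′} e = contradiction e (ℕₚ.even≢odd k k′)
    end-injective true  false {k} {k′} e = contradiction (sym e) (ℕₚ.even≢odd k′ k)

  module _ (d : ℕ) where

    private
      point : ℕ → Bool → ℤ → ℤ
      point k ε m = + end ε (d ℕ.+ 2 ℕ.* k) + m * + n

      letter : ℕ → ℕ
      letter k = d ℕ.+ 2 ℕ.* k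

      distinct : ∀ {k k′} ε ε′ m → k ℕ.< h → k′ ℕ.< h → k ≢ k′ → ¬ (_~_ n (point k ε m) (+ end ε′ (letter k′)))
      distinct {k} {k′} ε ε′ m k<h k′<h k≢k′ c with ~-trans n (~-sym n {point k ε m} (m , refl)) c
      ... | m′ , e = k≢k′ (end-injective ε ε′ (remainder-unique n (end-< ε k<h) (end-< ε′ k′<h) (m′ , by-difference e′ (lem (+ d) (+ end ε (2 ℕ.* k)) (+ end ε′ (2 ℕ.* k′)) (m′ * + n)))))
        where
        e′ : + d + + end ε (2 ℕ.* k) ≡ (+ d + + end ε′ (2 ℕ.* k′)) + m′ * + n
        e′ = subst₂ (λ a b → + a ≡ + b + m′ * + n) (end-+ ε d _) (end-+ ε′ d _) e
        lem : ∀ d a b c → a - (b + c) ≡ (d + a) - ((d + b) + c)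
        lem = solve-∀

      gen-same : ∀ k ε m → gen n (letter k) (point k ε m) ≡ point k (not ε) m
      gen-same k false m = gen-i (letter k) m
      gen-same k true  m = gen-suc (letter k) m

      gen-other : ∀ {k k′} ε m → k ℕ.< h → k′ ℕ.< h → k ≢ k′ → gen n (letter k′) (point k ε m) ≡ point k ε m
      gen-other {k} {k′} ε m k<h k′<h k≢k′ = gen-fixed (letter k′) _ (distinct ε false m k<h k′<h k≢k′) (distinct ε true m k<h k′<h k≢k′)

      outside : ∀ {k} ε m → k ℕ.< h → ∀ ks → All (ℕ._< h) ks → All (k ≢_) ks → prod n (map letter ks) (point k ε m) ≡ point k ε m
      outside ε m k<h [] [] [] = refl
      outside ε m k<h (k′ ∷ ks) (k′<h ∷ ks<h) (k≢k′ ∷ k∉) =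
        trans (cong (gen n (letter k′)) (outside ε m k<h ks ks<h k∉)) (gen-other ε m k<h k′<h k≢k′)

      -- The letters have equal parity and represent distinct classes modulo n, so their supports
      -- are disjoint and exactly one letter acts on the given point.
      inside : ∀ {k} ε m → k ℕ.< h → ∀ ks → All (ℕ._< h) ks → Unique ks → k ∈ ks → prod n (map letter ks) (point k ε m) ≡ point k (not ε) m
      inside {k} ε m k<h (k ∷ ks) (_ ∷ ks<h) (k∉ ∷ _) (here refl) =
        trans (cong (gen n (letter k)) (outside ε m k<h ks ks<h k∉)) (gen-same k ε m)
      inside {k} ε m k<h (k′ ∷ ks) (k′<h ∷ ks<h) (k′∉ ∷ uniq) (there k∈) =
        trans (cong (gen n (letter k′)) (inside ε m k<h ks ks<h uniq k∈)) (gen-other (not ε) m k<h k′<h (λ e → All.lookup k′∉ k∈ (sym e)))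

      swap : ∀ ε u → prod n (map letter (upTo h)) (+ end ε d + + 2 * u) ≡ + end (not ε) d + + 2 * u
      swap ε u with remainder h u
      ... | k , k<h , (q , refl) = subst₂ (λ a b → prod n (map letter (upTo h)) a ≡ b) (place ε) (place (not ε))
              (inside ε q k<h (upTo h) (All.tabulate ∈-upTo⁻) (upTo⁺ h) (∈-upTo⁺ k<h))
        where
        end-pos : ∀ ε i → + end ε (d ℕ.+ i) ≡ + end ε d + + i
        end-pos false i = refl
        end-pos true  i = refl
        place : ∀ ε → point k ε q ≡ + end ε d + + 2 * (+ k + q * + h)
        place ε = trans (cong₂ _+_ (trans (end-pos ε (2 ℕ.* k)) (cong (λ a → + end ε d + a) (pos-* 2 k))) (double-multiple q)) (lem (+ end ε d) (+ k) (q * + h))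
          where
          lem : ∀ a b c → (a + + 2 * b) + + 2 * c ≡ a + + 2 * (b + c)
          lem = solve-∀

    swap-lower : ∀ u → prod n (map letter (upTo h)) (+ d + + 2 * u) ≡ + 1 + (+ d + + 2 * u)
    swap-lower u = trans (swap false u) (+-assoc (+ 1) (+ d) (+ 2 * u))

    swap-upper : ∀ u → prod n (map letter (upTo h)) (+ 1 + (+ d + + 2 * u)) ≡ + d + + 2 * u
    swap-upper u = trans (cong (prod n (map letter (upTo h))) (sym (+-assoc (+ 1) (+ d) (+ 2 * u)))) (swap true u)

  private
    ⌊n/2⌋≡h : ⌊ n /2⌋ ≡ h
    ⌊n/2⌋≡h = go h
      where
      go : ∀ h → ⌊ h ℕ.* 2 /2⌋ ≡ h
      go zero    = refl
      go (suc h) = cong suc (go h)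

  Θ-lower : ∀ b u → Θ n b (lower b u) ≡ upper b u
  Θ-lower true  u rewrite ⌊n/2⌋≡h = swap-lower 1 u
  Θ-lower false u rewrite ⌊n/2⌋≡h = swap-lower 2 u

  Θ-upper : ∀ b u → Θ n b (upper b u) ≡ lower b u
  Θ-upper true  u rewrite ⌊n/2⌋≡h = swap-upper 1 u
  Θ-upper false u rewrite ⌊n/2⌋≡h = swap-upper 2 u

  lower⊎upper : ∀ b x → Σ ℤ λ u → x ≡ lower b u ⊎ x ≡ upper b u
  lower⊎upper b x with half (x - + offset b)
  ... | u , inj₁ e = u , inj₁ (by-difference e (lem x (+ offset b) (+ 2 * u)))
    where
    lem : ∀ x d a → x - (d + a) ≡ (x - d) - a
    lem = solve-∀
  ... | u , inj₂ e = u , inj₂ (by-difference e (lem x (+ offset b) (+ 2 * u)))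
    where
    lem : ∀ x d a → x - (+ 1 + (d + a)) ≡ (x - d) - (+ 1 + a)
    lem = solve-∀

  Θ-unique : ∀ b {f} → (∀ u → f (lower b u) ≡ upper b u) → (∀ u → f (upper b u) ≡ lower b u) → f ≈ Θ n b
  Θ-unique b lo up x with lower⊎upper b x
  ... | u , inj₁ refl = trans (lo u) (sym (Θ-lower b u))
  ... | u , inj₂ refl = trans (up u) (sym (Θ-upper b u))

  Θ-near : ∀ b → Near (Θ n b)
  Θ-near b = step⇒near step
    where
    step : ∀ x → Θ n b x ≡ x + + 1 ⊎ Θ n b x ≡ x - + 1 ⊎ Θ n b x ≡ x
    step x with lower⊎upper b x
    ... | u , inj₁ refl = inj₁ (trans (Θ-lower b u) (+-comm (+ 1) (lower b u)))
    ... | u , inj₂ refl = inj₂ (inj₁ (trans (Θ-upper b u) (lem (lower b u))))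
      where
      lem : ∀ a → a ≡ (+ 1 + a) - + 1
      lem = solve-∀

  -- If v carried Θ⁺ to Θ⁻, then it would send {2m+1, 2m+2} to some {2u+2, 2u+3}, where u permutes
  -- the residues modulo h = n/2; the displacements of v then sum to 2h modulo 4h instead of 0.
  Θ⁺≁Θ⁻ : ∀ {v} → Affine n v → ¬ ((Θ n false ∘ v) ≈ (v ∘ Θ n true))
  Θ⁺≁Θ⁻ {v} av conj = even≢odd (+ 0) c (*-cancelˡ-≡ (+ 2) (+ 2 * + 0) (+ 1 + + 2 * c)
      (*-cancelˡ-≡ (+ h) (+ 2 * (+ 2 * + 0)) (+ 2 * (+ 1 + + 2 * c)) (trans (*-zeroʳ (+ h)) (trans (sym total) (factor (+ h) c)))))
    where
    open Affine av
    V W : Map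
    V m = v (lower true m)
    W m = v (upper true m)

    W≡ : ∀ m → W m ≡ Θ n false (V m)
    W≡ m = trans (cong v (sym (Θ-lower true m))) (sym (conj _))
    V≡ : ∀ m → V m ≡ Θ n false (W m)
    V≡ m = trans (cong v (sym (Θ-upper true m))) (sym (conj _))

    -- `u m` indexes the cycle of Θ⁻ that contains `V m`: subtracting the offset and halving forgets
    -- which end of the cycle it is.
    u u⁻¹ : Map
    u m   = ⌊ V m - + 2 /2⌋ᶻ
    u⁻¹ x = ⌊ inverse (lower false x) - + 1 /2⌋ᶻ

    u-characterised : ∀ m {a} → V m ≡ lower false a ⊎ V m ≡ upper false a → u m ≡ a
    u-characterised m {a} (inj₁ e) = half-unique (inj₁ (trans (cong (λ a → a - + 2) e) (lem a)))
      where
      lem : ∀ a → (+ 2 + + 2 * a) - + 2 ≡ + 2 * a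
      lem = solve-∀
    u-characterised m {a} (inj₂ e) = half-unique (inj₂ (trans (cong (λ a → a - + 2) e) (lem a)))
      where
      lem : ∀ a → (+ 1 + (+ 2 + + 2 * a)) - + 2 ≡ + 1 + + 2 * a
      lem = solve-∀

    image : ∀ m → (V m ≡ lower false (u m) × W m ≡ upper false (u m)) ⊎ (V m ≡ upper false (u m) × W m ≡ lower false (u m))
    image m with lower⊎upper false (V m)
    ... | a , inj₁ e = inj₁ (subst (λ c → V m ≡ lower false c × W m ≡ upper false c) (sym (u-characterised m {a} (inj₁ e)))
                              (e , trans (W≡ m) (trans (cong (Θ n false) e) (Θ-lower false a))))
    ... | a , inj₂ e = inj₂ (subst (λ c → V m ≡ upper false c × W m ≡ lower false c) (sym (u-characterised m {a} (inj₂ e)))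
                              (e , trans (W≡ m) (trans (cong (Θ n false) e) (Θ-upper false a))))

    u⁻¹u : ∀ m → u⁻¹ (u m) ≡ m
    u⁻¹u m with image m
    ... | inj₁ (e , _) = half-unique (inj₁ (trans (cong (λ a → a - + 1) (trans (cong inverse (sym e)) (inverseˡ _))) (lem m)))
      where
      lem : ∀ m → (+ 1 + + 2 * m) - + 1 ≡ + 2 * m
      lem = solve-∀
    ... | inj₂ (_ , e) = half-unique (inj₂ (trans (cong (λ a → a - + 1) (trans (cong inverse (sym e)) (inverseˡ _))) (lem m)))
      where
      lem : ∀ m → (+ 1 + (+ 1 + + 2 * m)) - + 1 ≡ + 1 + + 2 * m
      lem = solve-∀

    uu⁻¹ : ∀ x → u (u⁻¹ x) ≡ x
    uu⁻¹ x with half (inverse (lower false x) - + 1)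
    ... | m , inj₁ e = u-characterised m {x} (inj₁ (trans (cong v (sym (by-difference e (lem (inverse (lower false x)) m)))) (inverseʳ _)))
      where
      lem : ∀ y m → y - (+ 1 + + 2 * m) ≡ (y - + 1) - + 2 * m
      lem = solve-∀
    ... | m , inj₂ e = u-characterised m {x} (inj₂ (trans (V≡ m) (trans (cong (Θ n false) (trans (cong v (sym (by-difference e (lem (inverse (lower false x)) m)))) (inverseʳ _))) (Θ-lower false x))))
      where
      lem : ∀ y m → y - (+ 1 + (+ 1 + + 2 * m)) ≡ (y - + 1) - (+ 1 + + 2 * m)
      lem = solve-∀

    V-shift : ∀ m q → V (m + q * + h) ≡ V m + + 2 * (q * + h)
    V-shift m q = trans (cong v (trans (lem m (q * + h)) (cong (λ a → lower true m + a) (sym (double-multiple q)))))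
                        (trans (shift _ q) (cong (λ a → V m + a) (double-multiple q)))
      where
      lem : ∀ m a → + 1 + + 2 * (m + a) ≡ (+ 1 + + 2 * m) + + 2 * a
      lem = solve-∀

    u-shift : Shift h u
    u-shift m q with image m
    ... | inj₁ (e , _) = u-characterised (m + q * + h) {u m + q * + h} (inj₁ (trans (V-shift m q) (trans (cong (λ a → a + + 2 * (q * + h)) e) (lem (u m) (q * + h)))))
      where
      lem : ∀ b a → (+ 2 + + 2 * b) + + 2 * a ≡ + 2 + + 2 * (b + a)
      lem = solve-∀
    ... | inj₂ (e , _) = u-characterised (m + q * + h) {u m + q * + h} (inj₂ (trans (V-shift m q) (trans (cong (λ a → a + + 2 * (q * + h)) e) (lem (u m) (q * + h)))))
      where
      lem : ∀ b a → (+ 1 + (+ 2 + + 2 * b)) + + 2 * a ≡ + 1 + (+ 2 + + 2 * (b + a))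
      lem = solve-∀

    multiple : Σ ℤ λ c → window h (λ x → u x - x) ≡ + h * c
    multiple = window-displacement-∣ h {u} {u⁻¹} u⁻¹u uu⁻¹ u-shift (shift-inverse h {u} {u⁻¹} u⁻¹u uu⁻¹ u-shift)
    c : ℤ
    c = proj₁ multiple

    -- In either order the image pair sums to 4 (`u m`) + 5, against 4 m + 3 for the original pair.
    pair-displacement : ∀ m → displacement n v (lower true m) + displacement n v (upper true m) ≡ + 2 + + 4 * (u m - m)
    pair-displacement m with image m
    ... | inj₁ (e , e′) = trans (cong₂ (λ a b → (a - lower true m) + (b - upper true m)) e e′) (lem m (u m))
      where
      lem : ∀ m a → ((+ 2 + + 2 * a) - (+ 1 + + 2 * m)) + ((+ 1 + (+ 2 + + 2 * a)) - (+ 1 + (+ 1 + + 2 * m))) ≡ + 2 + + 4 * (a - m)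
      lem = solve-∀
    ... | inj₂ (e , e′) = trans (cong₂ (λ a b → (a - lower true m) + (b - upper true m)) e e′) (lem m (u m))
      where
      lem : ∀ m a → ((+ 1 + (+ 2 + + 2 * a)) - (+ 1 + + 2 * m)) + ((+ 2 + + 2 * a) - (+ 1 + (+ 1 + + 2 * m))) ≡ + 2 + + 4 * (a - m)
      lem = solve-∀

    factor : ∀ k c → k * + 2 + + 4 * (k * c) ≡ k * (+ 2 * (+ 1 + + 2 * c))
    factor = solve-∀

    total : + h * + 2 + + 4 * (+ h * c) ≡ + 0
    total = begin
      + h * + 2 + + 4 * (+ h * c)
        ≡⟨ cong₂ _+_ (window-const h (+ 2)) (trans (window-* h (+ 4) (λ x → u x - x)) (cong (λ a → + 4 * a) (proj₂ multiple))) ⟨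
      window h (λ _ → + 2) + window h (λ m → + 4 * (u m - m))
        ≡⟨ window-+ h (λ _ → + 2) (λ m → + 4 * (u m - m)) ⟨
      window h (λ m → + 2 + + 4 * (u m - m))
        ≡⟨ window-cong h pair-displacement ⟨
      window h (λ m → displacement n v (lower true m) + displacement n v (upper true m))
        ≡⟨ window-pairs h (λ x → displacement n v (+ 1 + x)) ⟨
      window n (λ x → displacement n v (+ 1 + x))
        ≡⟨ window-suc n v shift ⟩
      window n (displacement n v)
        ≡⟨ balanced ⟩
      + 0 ∎
      where open ≡-Reasoning

  -- Conjugating by u ∘ v⁻¹ would carry one Θ to the other.
  same-Θ : ∀ {u v y b b′} → Affine n u → Affine n v →
           (Θ n b ∘ u) ≈ (u ∘ y) → (Θ n b′ ∘ v) ≈ (v ∘ y) → b ≡ b′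
  same-Θ {u} {v} {y} {b} {b′} au av eu ev = go b b′ conj
    where
    open Affine
    w : Map
    w = u ∘ inverse av
    aw : Affine n w
    aw = affine-∘ n au (affine-inverse n av)
    conj : (Θ n b ∘ w) ≈ (w ∘ Θ n b′)
    conj x = trans (eu _) (cong u (trans (sym (inverseˡ av _)) (cong (inverse av) (trans (sym (ev _)) (cong (Θ n b′) (inverseʳ av x))))))
    go : ∀ b b′ → (Θ n b ∘ w) ≈ (w ∘ Θ n b′) → b ≡ b′
    go true  true  _ = refl
    go false false _ = refl
    go false true  e = contradiction e (Θ⁺≁Θ⁻ aw)
    go true  false e = contradiction e′ (Θ⁺≁Θ⁻ (affine-inverse n aw))
      where
      e′ : (Θ n false ∘ inverse aw) ≈ (inverse aw ∘ Θ n true)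
      e′ x = trans (sym (inverseˡ aw _)) (cong (inverse aw) (trans (sym (e _)) (cong (Θ n true) (inverseʳ aw x))))

-- Reflections that conjugate a fixed-point-free involution z to a given y

near-bound : ∀ {σ} → Near σ → ∀ {p q} → p < q → ¬ (q < σ p)
near-bound near {p} p<q q<σp = <⇒≱ (≤-<-trans (i<j⇒suc[i]≤j p<q) q<σp) (proj₁ (near p))

<-+-multiple : ∀ n .{{_ : NonZero n}} a k → a < a + + suc k * + n
<-+-multiple (suc n) a k = subst (_< a + + suc k * + suc n) (+-identityʳ a) (+-monoʳ-< a (ℤ.+<+ (ℕ.s≤s ℕ.z≤n)))

module Conjugation (n : ℕ) .{{_ : NonZero n}} {z : Map}
                   (zz : ∀ x → z (z x) ≡ x) (free : ∀ x → z x ≢ x) (shz : Shift n z) where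

  open Reflection

  private
    infix 4 _≈ₙ_
    _≈ₙ_ : ℤ → ℤ → Set
    _≈ₙ_ = _~_ n

    ~-reverse : ∀ {a b} → z a ≈ₙ b → z b ≈ₙ a
    ~-reverse {a} {b} c = ~-sym n (subst (λ x → x ≈ₙ z b) (zz a) (~-image n z shz c))

  conj-reflection : ∀ {r} → Reflection n r → Reflection n (z ∘ r ∘ z)
  conj-reflection {r} R = reflection-conj n {r} {z} zz shz R

  -- Generic r: the points moved by r and their z-images lie in four distinct residue classes.
  -- Degenerate r: z swaps the two residue classes moved by r.
  Generic Degenerate : Map → Set
  Generic    r = ∀ x → r x ≢ x → r (z x) ≡ z x
  Degenerate r = ∀ x → r x ≢ x → z x ≈ₙ r x

  -- By `~-moved` the fixed-point-free `z` preserves no residue class. So if `z` maps a moved class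
  -- of `r` to a moved class, it exchanges the two, and testing at `base` suffices.
  generic⊎degenerate : ∀ {r} → Reflection n r → Generic r ⊎ Degenerate r
  generic⊎degenerate {r} R with _~?_ n (z (base R)) (r (base R))
  ... | yes c = inj₂ degenerate
    where
    degenerate : Degenerate r
    degenerate x rx≢x with supp R x
    ... | inj₁ e        = contradiction e rx≢x
    ... | inj₂ (inj₁ d) = ~-trans n (~-image n z shz d) (~-trans n c (~-image n r (shift R) (~-sym n d)))
    ... | inj₂ (inj₂ d) = ~-trans n (~-image n z shz d) (~-trans n (~-reverse c)
                            (subst (λ a → a ≈ₙ r x) (invol R _) (~-image n r (shift R) (~-sym n d))))
  ... | no ¬c = inj₁ generic
    where
    fixed-class : ∀ {x b} → x ≈ₙ b → ¬ (z x ≈ₙ b)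
    fixed-class d d′ = free _ (~-moved n zz shz (~-trans n d′ (~-sym n d)))
    generic : Generic r
    generic x rx≢x with supp R x | supp R (z x)
    ... | inj₁ e        | _              = contradiction e rx≢x
    ... | _             | inj₁ e         = e
    ... | inj₂ (inj₁ d) | inj₂ (inj₁ d′) = contradiction d′ (fixed-class d)
    ... | inj₂ (inj₂ d) | inj₂ (inj₂ d′) = contradiction d′ (fixed-class d)
    ... | inj₂ (inj₁ d) | inj₂ (inj₂ d′) = contradiction (~-trans n (~-image n z shz (~-sym n d)) d′) ¬c
    ... | inj₂ (inj₂ d) | inj₂ (inj₁ d′) = contradiction (~-trans n (~-reverse d′) d) ¬c

  moved-image : ∀ {r} → Reflection n r → ∀ {x} → r x ≢ x → r (r x) ≢ r x
  moved-image R rx≢x e = rx≢x (inj R e)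

  -- For generic `r` the reflections `r` and `z ∘ r ∘ z` have disjoint supports and commute; both
  -- sides are their product followed on the right by `z`.
  generic-conj : ∀ {r} → Reflection n r → Generic r → (r ∘ z ∘ r) ≈ ((z ∘ r ∘ z) ∘ z ∘ (z ∘ r ∘ z))
  generic-conj {r} R g x = trans (main x) (sym (cong (z ∘ r) (zz _)))
    where
    main : ∀ x → r (z (r x)) ≡ z (r (z (r (z x))))
    main x with r x ℤ.≟ x | r (z x) ℤ.≟ z x
    ... | no rx≢x | _ = trans (g (r x) (moved-image R rx≢x)) (cong (z ∘ r) (sym (trans (cong z (g x rx≢x)) (zz x))))
    ... | yes rx≡x | yes e = trans (trans (cong (r ∘ z) rx≡x) e)
                               (sym (cong z (trans (cong (r ∘ z) e) (trans (cong r (zz x)) rx≡x))))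
    ... | yes rx≡x | no ne = trans (cong (r ∘ z) rx≡x) (sym (trans (cong z (g (r (z x)) (moved-image R ne))) (zz _)))

  generic-value : ∀ {r x} → Reflection n r → Generic r → r x ≢ x → r (z (r x)) ≡ z (r x)
  generic-value {r} {x} R g rx≢x = g (r x) (moved-image R rx≢x)

  -- Conjugation by `r` reverses the sign of `m`. So `r x` is the midpoint of the two values, which
  -- `double` records.
  degenerate-value : ∀ {r x m} → Reflection n r → z x ≡ r x + m * + n → r (z (r x)) ≡ r x + - m * + n
  degenerate-value {r} {x} {m} R e = trans (cong r zrx) (shift R x (- m))
    where
    zrx : z (r x) ≡ x + - m * + n
    zrx = by-difference (trans (sym (shz (r x) m)) (trans (cong z (sym e)) (zz x))) (lem (z (r x)) x m (+ n))
      where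
      lem : ∀ a x m k → a - (x + - m * k) ≡ (a + m * k) - x
      lem = solve-∀

  private
    double : ∀ {r x} → Reflection n r → z x ≈ₙ r x → + 2 * r x ≡ z x + r (z (r x))
    double {r} {x} R (m , e) = sym (trans (cong₂ _+_ e (degenerate-value {m = m} R e)) (lem (r x) m (+ n)))
      where
      lem : ∀ a m k → (a + m * k) + (a + - m * k) ≡ + 2 * a
      lem = solve-∀

    close : ∀ {r x} → Reflection n r → z x ≈ₙ r x → r (z (r x)) ≈ₙ z x
    close R c@(m , e) = ~-trans n (- m , degenerate-value {m = m} R e) (~-sym n c)

    far : ∀ {r x} → Reflection n r → Generic r → r x ≢ x → ¬ (r (z (r x)) ≈ₙ z x)
    far {r} {x} R g rx≢x c = moved-≁ n R rx≢x (subst₂ _≈ₙ_ (zz (r x)) (zz x)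
      (~-image n z shz (subst (λ a → a ≈ₙ z x) (generic-value R g rx≢x) c)))

  degenerate-fixed : ∀ {r x} → Reflection n r → z x ≈ₙ r x → r (z (r x)) ≡ z x → z x ≡ r x
  degenerate-fixed {r} {x} R c e = sym (*-cancelˡ-≡ (+ 2) (r x) (z x)
    (trans (double R c) (trans (cong (λ a → z x + a) e) (lem (z x)))))
    where
    lem : ∀ a → a + a ≡ + 2 * a
    lem = solve-∀

  -- This provides the second descent when `z` is shortened on both sides. If `s` undid the first
  -- one, it would send `z (s x)` to `z x`; a generic `s` fixes `z (s x)`, and a degenerate one
  -- would give `z x ≡ s x`.
  conj-descends : ∀ {s x} → Reflection n s → Near s → x < s x → z (s x) < z x → z x ≢ s x → s (z (s x)) < s (z x)
  conj-descends {s} {x} S near x<sx desc ne with ≢⇒<⊎> (λ e → <⇒≢ desc (inj S e))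
  ... | inj₁ lt = lt
  ... | inj₂ gt with near-inversion near desc gt | generic⊎degenerate S
  ...   | e | inj₁ g = contradiction (trans (sym (g (s x) λ e′ → <⇒≢ x<sx (sym (inj S e′)))) e) (<⇒≢ desc)
  ...   | e | inj₂ d = contradiction (degenerate-fixed S (d x λ e′ → <⇒≢ x<sx (sym e′)) e) ne

  -- `r x` is recovered from the conjugate's value by applying `z` (generic) or as a midpoint
  -- (degenerate). Whether that value is congruent to `z x` tells the two cases apart.
  conj-determines : ∀ {r r′ x} → Reflection n r → Reflection n r′ → r x ≢ x → r′ x ≢ x →
                    r (z (r x)) ≡ r′ (z (r′ x)) → r x ≡ r′ x
  conj-determines {r} {r′} {x} R R′ m m′ e with generic⊎degenerate R | generic⊎degenerate R′
  ... | inj₁ g | inj₁ g′ = involution-injective z zz (trans (sym (generic-value R g m)) (trans e (generic-value R′ g′ m′)))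
  ... | inj₁ g | inj₂ d′ = contradiction (subst (λ a → a ≈ₙ z x) (sym e) (close R′ (d′ x m′))) (far R g m)
  ... | inj₂ d | inj₁ g′ = contradiction (subst (λ a → a ≈ₙ z x) e (close R (d x m))) (far R′ g′ m′)
  ... | inj₂ d | inj₂ d′ = *-cancelˡ-≡ (+ 2) (r x) (r′ x)
          (trans (double R (d x m)) (trans (cong (λ a → z x + a) e) (sym (double R′ (d′ x m′)))))

  reflections-agree : ∀ {r r′ x} → Reflection n r → Reflection n r′ → r x ≢ x → r x ≡ r′ x → r ≈ r′
  reflections-agree R R′ rx≢x e = intertwine n {id} {id} (λ _ → refl) (λ _ _ → refl) (λ _ _ → refl) R R′ rx≢x e

  module _ {y : Map} (y≉z : ¬ (y ≈ z)) where

    -- If `z` and `r` agreed at a moved point, they would commute, and the conjugate `y` would be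
    -- `z` itself.
    not-commuting : ∀ {r} → Reflection n r → y ≈ (r ∘ z ∘ r) → ∀ {x} → r x ≢ x → z x ≢ r x
    not-commuting {r} R e {x} rx≢x zx≡rx = y≉z λ a → trans (e a) (trans (cong r (commute a)) (invol R (z a)))
      where
      commute : (z ∘ r) ≈ (r ∘ z)
      commute = intertwine n {z} {z} zz shz shz R R rx≢x
        (trans (cong z (sym zx≡rx)) (trans (zz x) (trans (sym (invol R x)) (cong r (sym zx≡rx)))))

    conj-moves : ∀ {r} → Reflection n r → y ≈ (r ∘ z ∘ r) → ∀ {x} → r x ≢ x → y x ≢ z x
    conj-moves {r} R e {x} rx≢x yx≡zx with generic⊎degenerate R
    ... | inj₁ g = far R g rx≢x (+ 0 , trans (trans (sym (e x)) yx≡zx) (sym (lem (z x) (+ n))))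
      where
      lem : ∀ a k → a + + 0 * k ≡ a
      lem = solve-∀
    ... | inj₂ d = not-commuting R e rx≢x (degenerate-fixed R (d x rx≢x) (trans (sym (e x)) yx≡zx))

    -- Since `y` and `z` differ at the base k of `r′`, the reflection `r` moves k or `z k`. If it
    -- moves k, the value `y k` identifies it with `r′`. If it moves only `z k`, it is generic, and
    -- `z ∘ r ∘ z` moves k and yields the same `y`.
    conjugators : ∀ {r r′} → Reflection n r → Reflection n r′ → y ≈ (r ∘ z ∘ r) → y ≈ (r′ ∘ z ∘ r′) →
                  r ≈ r′ ⊎ (Generic r × (z ∘ r ∘ z) ≈ r′)
    conjugators {r} {r′} R R′ e e′ with r k ℤ.≟ k | r (z k) ℤ.≟ z k
      where
      k = base R′
    ... | no m | _ = inj₁ (reflections-agree R R′ m (conj-determines R R′ m (moved R′) (trans (sym (e _)) (e′ _))))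
    ... | yes f | yes f′ = contradiction (trans (e _) (trans (cong (r ∘ z) f) f′)) (conj-moves R′ e′ (moved R′))
    ... | yes f | no m with generic⊎degenerate R
    ...   | inj₂ d = contradiction f (moved-class (~-trans n (subst (λ a → a ≈ₙ r (z k)) (zz k) (d (z k) m)) (+ 0 , refl′)))
      where
      k = base R′
      refl′ : r (z k) ≡ r (z k) + + 0 * + n
      refl′ = sym (trans (cong (λ a → r (z k) + a) (*-zeroˡ (+ n))) (+-identityʳ _))
      moved-class : k ≈ₙ r (z k) → r k ≢ k
      moved-class (q , eq) rk≡k = moved-image R m (cancel (trans (sym (shift R _ q)) (trans (cong r (sym eq)) (trans rk≡k eq))))
        where
        cancel : ∀ {a b c} → a + c ≡ b + c → a ≡ b
        cancel {a} {b} {c} p = by-difference p (lem a b c)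
          where
          lem : ∀ a b c → a - b ≡ (a + c) - (b + c)
          lem = solve-∀
    ...   | inj₁ g = inj₂ (g , reflections-agree R″ R′ moved″
                       (conj-determines R″ R′ moved″ (moved R′) (trans (sym (trans (e k) (generic-conj R g k))) (e′ k))))
      where
      k = base R′
      R″ : Reflection n (z ∘ r ∘ z)
      R″ = conj-reflection R
      moved″ : z (r (z k)) ≢ k
      moved″ q = m (trans (sym (zz _)) (cong z q))

    -- Crossings: σ v = v y compared with σ w = w z

    module _ {σ v w : Map} (near : Near σ)
             (shv : Shift n v) (injv : ∀ {a b} → v a ≡ v b → a ≡ b) (σv : (σ ∘ v) ≈ (v ∘ y))
             (shw : Shift n w) (injw : ∀ {a b} → w a ≡ w b → a ≡ b) (σw : (σ ∘ w) ≈ (w ∘ z))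
             (ascends : ∀ {r} → Reflection n r → y ≈ (r ∘ z ∘ r) → Ascends r v) where

      -- Otherwise `v` would ascend along both `r` and `z ∘ r ∘ z`. As `y` maps `i` to `z (r i)` and
      -- `r i` to `z i`, the map `σ` would reverse `v i` and `v (r i)`, hence send the first to the
      -- second, and `z` would fix `r i`.
      generic-crossing : ∀ {r} → Reflection n r → y ≈ (r ∘ z ∘ r) → Generic r → ∀ {i} → i < r i → z (r i) < z i
      generic-crossing {r} R e g {i} i<ri with ≢⇒<⊎> (λ q → <⇒≢ i<ri (involution-injective z zz q))
      ... | inj₂ lt = lt
      ... | inj₁ lt = contradiction (injv stuck) (free (r i))
        where
        ri≢i : r i ≢ i
        ri≢i q = <⇒≢ i<ri (sym q)
        r″zi : z (r (z (z i))) ≡ z (r i)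
        r″zi = cong (z ∘ r) (zz i)
        below : v (z i) < v (z (r i))
        below = subst (λ a → v (z i) < v a) r″zi
                  (ascends (conj-reflection R) (λ x → trans (e x) (generic-conj R g x)) (z i) (subst (z i <_) (sym r″zi) lt))
        at-i : σ (v i) ≡ v (z (r i))
        at-i = trans (σv i) (cong v (trans (e i) (generic-value R g ri≢i)))
        at-ri : σ (v (r i)) ≡ v (z i)
        at-ri = trans (σv (r i)) (cong v (trans (e (r i)) (trans (cong (r ∘ z) (invol R i)) (g i ri≢i))))
        stuck : v (z (r i)) ≡ v (r i)
        stuck = trans (sym at-i) (near-inversion near (ascends R e i i<ri) (subst₂ _<_ (sym at-ri) (sym at-i) below))

      -- With `z i` = `r i` + m n, the case m = 0 means commuting. For m < 0, `σ` would carry `v i`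
      -- beyond `v (r i)`, farther than one step; for m > 0 the same happens to `w`, unless `w`
      -- descends.
      degenerate-descent : ∀ {r} → Reflection n r → y ≈ (r ∘ z ∘ r) → ∀ {i} → i < r i → z i ≈ₙ r i → w (r i) < w i
      degenerate-descent {r} R e {i} i<ri (m , eq) with ≢⇒<⊎> (λ q → <⇒≢ i<ri (injw q))
      ... | inj₂ desc = desc
      ... | inj₁ asc  = contradiction (go m eq) λ ()
        where
        at-i : ∀ m → z i ≡ r i + m * + n → σ (v i) ≡ v (r i) + - m * + n
        at-i m eq = trans (σv i) (trans (cong v (trans (e i) (degenerate-value {m = m} R eq))) (shv (r i) (- m)))
        go : ∀ m → z i ≡ r i + m * + n → ⊥
        go (+ zero)  eq = not-commuting R e (λ q → <⇒≢ i<ri (sym q))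
                            (trans eq (trans (cong (λ a → r i + a) (*-zeroˡ (+ n))) (+-identityʳ _)))
        go (+ suc k) eq = near-bound near asc (subst (w (r i) <_) (sym (trans (σw i) (trans (cong w eq) (shw (r i) (+ suc k)))))
                            (<-+-multiple n (w (r i)) k))
        go -[1+ k ]  eq = near-bound near (ascends R e i i<ri) (subst (v (r i) <_) (sym (at-i -[1+ k ] eq)) (<-+-multiple n (v (r i)) k))

      descending-conjugator : ∀ {t} → Reflection n t → y ≈ (t ∘ z ∘ t) →
                              Σ Map λ r → Reflection n r × y ≈ (r ∘ z ∘ r) × Descends r w
      descending-conjugator {t} T e with ascending-point n T
      ... | i , i<ti with generic⊎degenerate T
      ...   | inj₂ d = t , T , e , descends-at n T shw i<ti (degenerate-descent T e i<ti (d i (λ q → <⇒≢ i<ti (sym q))))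
      ...   | inj₁ g with ≢⇒<⊎> (λ q → <⇒≢ i<ti (injw q))
      ...     | inj₂ desc = t , T , e , descends-at n T shw i<ti desc
      ...     | inj₁ asc with ≢⇒<⊎> (λ q → <⇒≢ i<ti (involution-injective z zz (injw q)))
      -- By `generic-crossing` the rising point of the second candidate is `z (t i)`, with image
      -- `z i`; the ascent `asc″` is therefore a descent along it.
      ...       | inj₁ asc″ = z ∘ t ∘ z , T″ , (λ x → trans (e x) (generic-conj T g x)) ,
                    descends-at n T″ shw (subst (z (t i) <_) (sym t″zti) (generic-crossing T e g i<ti))
                                (subst (λ a → w a < w (z (t i))) (sym t″zti) asc″)
        where
        T″ : Reflection n (z ∘ t ∘ z)
        T″ = conj-reflection T
        t″zti : z (t (z (z (t i)))) ≡ z i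
        t″zti = cong z (trans (cong t (zz (t i))) (invol T i))
      -- Neither candidate is inverted: `σ` then reverses `w i` and `w (t i)`, so it maps one to the
      -- other, and `z i ≡ t i`.
      ...       | inj₂ desc″ = contradiction (injw (trans (sym (σw i)) (near-inversion near asc
                    (subst₂ _<_ (sym (σw (t i))) (sym (σw i)) desc″)))) (not-commuting T e (λ q → <⇒≢ i<ti (sym q)))

      -- If `w` inverted both `r` and `z ∘ r ∘ z`, then `σ` would reverse `w (r i)` and `w i`,
      -- forcing `z (r i) ≡ i` and so a commuting `r`.
      descending-conjugator-unique : ∀ {r r′} → Reflection n r → Reflection n r′ →
        y ≈ (r ∘ z ∘ r) → y ≈ (r′ ∘ z ∘ r′) → Descends r w → Descends r′ w → r ≈ r′
      descending-conjugator-unique {r} {r′} R R′ e e′ desc desc′ with conjugators R R′ e e′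
      ... | inj₁ agree = agree
      ... | inj₂ (g , agree) with ascending-point n R
      ...   | i , i<ri = contradiction (trans (cong z (sym (injw stuck))) (zz (r i))) (not-commuting R e (λ q → <⇒≢ i<ri (sym q)))
        where
        r′zri : r′ (z (r i)) ≡ z i
        r′zri = trans (sym (agree _)) (cong z (trans (cong r (zz (r i))) (invol R i)))
        below : w (z i) < w (z (r i))
        below = subst (λ a → w a < w (z (r i))) r′zri
                  (desc′ (z (r i)) (subst (z (r i) <_) (sym r′zri) (generic-crossing R e g i<ri)))
        stuck : w (z (r i)) ≡ w i
        stuck = trans (sym (σw (r i))) (near-inversion near (desc i i<ri) (subst₂ _<_ (sym (σw i)) (sym (σw (r i))) below))

-- Descent from z to Θ by simple conjugations

module FPF (h : ℕ) (2≤n : 2 ℕ.≤ h ℕ.* 2) where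

  open Theta h 2≤n
  open Words n 2≤n
  open Reflection

  record FixedPointFree (z : Map) : Set where
    field
      affine : Affine n z
      zz     : ∀ x → z (z x) ≡ x
      free   : ∀ x → z x ≢ x

    open Affine affine public using () renaming (shift to shz)
    open Conjugation n zz free shz public

  hasWord-affine : ∀ {f k} → HasWord n f k → Affine n f
  hasWord-affine {f} (w , _ , _ , p) = record
    { inverse  = inverse aw
    ; inverseˡ = λ x → trans (cong (inverse aw) (sym (p x))) (inverseˡ aw x)
    ; inverseʳ = λ x → trans (sym (p _)) (inverseʳ aw x)
    ; shift    = λ x m → trans (sym (p _)) (trans (shift aw x m) (cong (_+ m * + n) (p x)))
    ; balanced = trans (window-cong n (λ x → cong (_- x) (sym (p x)))) (balanced aw)
    }
    where
    open Affine
    go : ∀ w → Affine n (prod n w)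
    go []      = affine-id n
    go (i ∷ w) = affine-∘ n (affine-reflection n (gen-refl i)) (go w)
    aw : Affine n (prod n w)
    aw = go w

  -- Outcome of the descent: the simple reflections used multiply to `v`, each accounts for two
  -- units of the length `k`, and the rest is the length of Θ.
  record Reduction (z : Map) (k : ℕ) : Set where
    field
      sign    : Bool
      v       : Map
      size    : ℕ
      v-word  : HasWord n v size
      v-conj  : (Θ n sign ∘ v) ≈ (v ∘ z)
      Θ-size  : ℕ
      Θ-len   : IsLength n (Θ n sign) Θ-size
      total   : k ≡ size ℕ.+ size ℕ.+ Θ-size

  -- The second condition excludes neighbours swapped by `z`: there the simple reflection commutes
  -- with `z`, and conjugation changes nothing.
  AdjacentDescent : Map → ℤ → Set
  AdjacentDescent z x = z (+ 1 + x) < z x × z x ≢ + 1 + x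

  module _ {z : Map} (fz : FixedPointFree z) where

    open FixedPointFree fz

    private
      injz : ∀ {x y} → z x ≡ z y → x ≡ y
      injz = involution-injective z zz

    module _ (none : ∀ x → ¬ AdjacentDescent z x) where

      private
        climb-step : ∀ {x} → + 1 + x < z x → + 1 + (+ 1 + x) < z (+ 1 + x)
        climb-step {x} lt with ≢⇒<⊎> (λ e → i≢suc[i] (injz {x} {+ 1 + x} e))
        ... | inj₂ gt  = contradiction (gt , λ e → <⇒≢ lt (sym e)) (none x)
        ... | inj₁ gt  = ≤-<-trans (i<j⇒suc[i]≤j lt) gt

        climb : ∀ {x} → + 1 + x < z x → ∀ m → + 1 + (+ m + x) < z (+ m + x)
        climb {x} lt zero    = subst (λ a → + 1 + a < z a) (sym (+-identityˡ x)) lt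
        climb {x} lt (suc m) = subst (λ a → + 1 + a < z a) (sym (+-assoc (+ 1) (+ m) x)) (climb-step (climb lt m))

      -- Otherwise z x′ > x′ + 1 would persist for all x′ ≥ x, in particular for x′ = z x.
      image-bound : ∀ x → z x ≤ + 1 + x
      image-bound x = ≮⇒≥ λ lt → contradiction (climb lt ∣ z x - x ∣) (absurd lt)
        where
        absurd : + 1 + x < z x → ¬ (+ 1 + (+ ∣ z x - x ∣ + x) < z (+ ∣ z x - x ∣ + x))
        absurd lt lt′ = <-asym x<zx (≤-<-trans (i≤suc[i] (z x)) (subst (+ 1 + z x <_) (zz x) (subst (λ a → + 1 + a < z a) reach lt′)))
          where
          x<zx : x < z x
          x<zx = ≤-<-trans (i≤suc[i] x) lt
          reach : + ∣ z x - x ∣ + x ≡ z x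
          reach = trans (cong (_+ x) (0≤i⇒+∣i∣≡i (i≤j⇒0≤j-i (<⇒≤ x<zx)))) (lem (z x) x)
            where
            lem : ∀ a b → (a - b) + b ≡ a
            lem = solve-∀

      neighbour : ∀ x → z x ≡ + 1 + x ⊎ x ≡ + 1 + z x
      neighbour x with ≢⇒<⊎> (free x)
      ... | inj₂ gt = inj₁ (≤-antisym (image-bound x) (i<j⇒suc[i]≤j gt))
      ... | inj₁ lt = inj₂ (≤-antisym (subst (_≤ + 1 + z x) (zz x) (image-bound (z x))) (i<j⇒suc[i]≤j lt))

      private
        -- The point c + 2 cannot go down to c + 1, which is already paired with c; so adjacent
        -- pairs propagate.
        skip : ∀ {c} → z c ≡ + 1 + c → z (+ 2 + c) ≡ + 1 + (+ 2 + c)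
        skip {c} e with neighbour (+ 2 + c)
        ... | inj₁ up = up
        ... | inj₂ dn = contradiction (by-difference {c = + 0} {d = + 2} c≡2+c (lem₂ c)) λ ()
          where
          lem₁ : ∀ c a → a - (+ 1 + c) ≡ (+ 1 + a) - (+ 2 + c)
          lem₁ = solve-∀
          lem₂ : ∀ c → + 0 - + 2 ≡ c - (+ 2 + c)
          lem₂ = solve-∀
          c≡2+c : c ≡ + 2 + c
          c≡2+c = trans (sym (zz c)) (trans (cong z (trans e (sym (by-difference (sym dn) (lem₁ c (z (+ 2 + c))))))) (zz _))

        run : ∀ b → z (+ offset b) ≡ + 1 + + offset b → ∀ k → z (lower b (+ k)) ≡ upper b (+ k)
        run b e zero    = trans (cong z (+-identityʳ (+ offset b))) (trans e (cong (λ a → + 1 + a) (sym (+-identityʳ (+ offset b)))))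
        run b e (suc k) = subst (λ a → z a ≡ + 1 + a) (lem (+ offset b) (+ k)) (skip (run b e k))
          where
          lem : ∀ d k → + 2 + (d + + 2 * k) ≡ d + + 2 * (+ 1 + k)
          lem = solve-∀

        run-lower : ∀ b → z (+ offset b) ≡ + 1 + + offset b → ∀ u → z (lower b u) ≡ upper b u
        run-lower b e u with remainder h u
        ... | k , _ , (q , refl) = subst (λ a → z a ≡ + 1 + a) (place q) (trans (shz _ q) (trans (cong (_+ q * + n) (run b e k)) (+-assoc (+ 1) (lower b (+ k)) (q * + n))))
          where
          lem : ∀ d a c → (d + + 2 * a) + + 2 * c ≡ d + + 2 * (a + c)
          lem = solve-∀
          place : ∀ q → lower b (+ k) + q * + n ≡ lower b (+ k + q * + h)
          place q = trans (cong (λ a → lower b (+ k) + a) (double-multiple q)) (lem (+ offset b) (+ k) (q * + h))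

        matches : ∀ b → z (+ offset b) ≡ + 1 + + offset b → z ≈ Θ n b
        matches b e = Θ-unique b (run-lower b e) (λ u → trans (cong z (sym (run-lower b e u))) (zz _))

      no-adjacent-descent⇒Θ : Σ Bool λ b → z ≈ Θ n b
      no-adjacent-descent⇒Θ with neighbour (+ 1) | neighbour (+ 2)
      ... | inj₁ e | _      = true , matches true e
      ... | _      | inj₁ e = false , matches false e
      -- If 2 goes down, it is paired with 1, so 1 goes up.
      ... | inj₂ e | inj₂ e′ = contradiction z≡ λ ()
        where
        lem′ : ∀ a → a - + 1 ≡ (+ 1 + a) - + 2
        lem′ = solve-∀
        z2 : z (+ 2) ≡ + 1
        z2 = by-difference (sym e′) (lem′ (z (+ 2)))
        z≡ : + 1 + + 2 ≡ + 1
        z≡ = trans (cong (λ a → + 1 + a) (trans (sym (zz (+ 2))) (cong z z2))) (sym e)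

    AdjacentDescent-shift : ∀ {x m} → AdjacentDescent z (x + m * + n) → AdjacentDescent z x
    AdjacentDescent-shift {x} {m} (lt , ne) =
      subst₂ _<_ (lem₂ (z (+ 1 + x)) (m * + n)) (lem₂ (z x) (m * + n)) (+-monoˡ-< (- (m * + n)) (subst₂ _<_ up (shz x m) lt)) ,
      λ e → ne (trans (shz x m) (trans (cong (_+ m * + n) e) (+-assoc (+ 1) x (m * + n))))
      where
      up : z (+ 1 + (x + m * + n)) ≡ z (+ 1 + x) + m * + n
      up = trans (cong z (sym (+-assoc (+ 1) x (m * + n)))) (shz _ m)
      lem₂ : ∀ a c → (a + c) + - c ≡ a
      lem₂ = solve-∀

    adjacent-descent? : (∃ λ k → k ℕ.< n × AdjacentDescent z (+ suc k)) ⊎ (∀ x → ¬ AdjacentDescent z x)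
    adjacent-descent? with ℕₚ.anyUpTo? (λ k → (z (+ 1 + + suc k) ℤ.<? z (+ suc k)) ×-dec ¬? (z (+ suc k) ℤ.≟ + 1 + + suc k)) n
    ... | yes found = inj₁ found
    ... | no ¬found = inj₂ none
      where
      none : ∀ x → ¬ AdjacentDescent z x
      none x d with remainder n (x - + 1)
      ... | k , k<n , (m , e) = ¬found (k , k<n , AdjacentDescent-shift {+ suc k} {m} (subst (AdjacentDescent z) (by-difference e (lem x (+ k) (m * + n))) d))
        where
        lem : ∀ x k a → x - ((+ 1 + k) + a) ≡ (x - + 1) - (k + a)
        lem = solve-∀

    fixedPointFree-conj : ∀ i → FixedPointFree (gen n i ∘ z ∘ gen n i)
    fixedPointFree-conj i = record
      { affine = affine-∘ n as (affine-∘ n affine as)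
      ; zz     = λ x → trans (cong (s ∘ z) (invol S _)) (trans (cong s (zz _)) (invol S x))
      ; free   = λ x e → free (s x) (trans (sym (invol S _)) (cong s e))
      }
      where
      s : Map
      s = gen n i
      S : Reflection n s
      S = gen-refl i
      as : Affine n s
      as = affine-reflection n S

    -- Exchange removes a letter on the right; inverting and exchanging again removes the one on the
    -- left. The resulting length is exact because conjugating back costs at most two letters.
    conj-shortens : ∀ {k i} → InRange n i → AdjacentDescent z (+ i) → IsLength n z k →
                    ∃ λ m → k ≡ suc (suc m) × IsLength n (gen n i ∘ z ∘ gen n i) m
    conj-shortens {k} {i} ok (lt , ne) (word , least) = m , k≡ , word₃ , least₃
      where
      s : Map
      s = gen n i
      S : Reflection n s
      S = gen-refl i
      si : s (+ i) ≡ + suc i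
      si = gen-at i
      i<si : + i < s (+ i)
      i<si = subst (+ i <_) (sym si) (ℤ.+<+ (ℕₚ.n<1+n i))
      lt′ : z (s (+ i)) < z (+ i)
      lt′ = subst (λ a → z a < z (+ i)) (sym si) lt
      step₁ : ∃ λ m → k ≡ suc m × HasWord n (z ∘ s) m
      step₁ = exchange {t = s} {f = z} S i<si lt′ word
      word₂ : HasWord n (s ∘ z) (proj₁ step₁)
      word₂ = hasWord-inverse {f = z ∘ s} {g = s ∘ z} (λ x → trans (cong z (invol S _)) (zz x)) (proj₂ (proj₂ step₁))
      desc : s (z (s (+ i))) < s (z (+ i))
      desc = conj-descends S (gen-near i) i<si lt′ (λ e → ne (trans e si))
      step₂ : ∃ λ m → proj₁ step₁ ≡ suc m × HasWord n (s ∘ z ∘ s) m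
      step₂ = exchange {t = s} {f = s ∘ z} S i<si desc word₂
      m : ℕ
      m = proj₁ step₂
      word₃ : HasWord n (s ∘ z ∘ s) m
      word₃ = proj₂ (proj₂ step₂)
      k≡ : k ≡ suc (suc m)
      k≡ = trans (proj₁ (proj₂ step₁)) (cong suc (proj₁ (proj₂ step₂)))
      least₃ : ∀ w → All (InRange n) w → prod n w ≈ (s ∘ z ∘ s) → m ℕ.≤ length w
      least₃ w okw p = ℕ.s≤s⁻¹ (ℕ.s≤s⁻¹ (subst₂ ℕ._≤_ k≡ (cong suc (ℕₚ.+-comm (length w) 1)) (isLength-≤ (word , least) conjugate)))
        where
        conjugate : HasWord n z (1 ℕ.+ (length w ℕ.+ 1))
        conjugate = hasWord-≈ {f = s ∘ prod n w ∘ s} (λ x → trans (cong s (p (s x))) (trans (invol S _) (cong z (invol S x))))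
          (hasWord-∘ {s} {prod n w ∘ s} (gen-hasWord ok) (hasWord-∘ {prod n w} {s} (w , okw , refl , λ _ → refl) (gen-hasWord ok)))

  Θ-reduction : ∀ {z k} → (Σ Bool λ b → z ≈ Θ n b) → IsLength n z k → Reduction z k
  Θ-reduction {z} {k} (b , z≈Θ) len = record
    { sign = b ; v = id ; size = 0
    ; v-word = [] , [] , refl , (λ _ → refl)
    ; v-conj = λ x → sym (z≈Θ x)
    ; Θ-size = k ; Θ-len = isLength-≈ z≈Θ len ; total = refl }

  conj-reduction : ∀ {z i m} → InRange n i → Reduction (gen n i ∘ z ∘ gen n i) m → Reduction z (suc (suc m))
  conj-reduction {z} {i} ok red = record
    { sign = sign ; v = v ∘ gen n i ; size = size ℕ.+ 1
    ; v-word = hasWord-∘ {v} {gen n i} v-word (gen-hasWord ok)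
    ; v-conj = λ x → trans (v-conj (gen n i x)) (cong v (cong (gen n i ∘ z) (invol (gen-refl i) x)))
    ; Θ-size = Θ-size ; Θ-len = Θ-len
    ; total = trans (cong (2 ℕ.+_) total) (lem size Θ-size) }
    where
    open Reduction red
    lem : ∀ a c → 2 ℕ.+ (a ℕ.+ a ℕ.+ c) ≡ (a ℕ.+ 1) ℕ.+ (a ℕ.+ 1) ℕ.+ c
    lem = ℕ-Solver.solve-∀

  private
    reduce-step : ∀ {k} → (∀ {m} → m ℕ.< k → ∀ {z} → FixedPointFree z → IsLength n z m → Reduction z m) →
                  ∀ {z} → FixedPointFree z → IsLength n z k → Reduction z k
    reduce-step {k} recurse {z} fz len = go (adjacent-descent? fz)
      where
      shorten : ∀ {i} → InRange n i → (∃ λ m → k ≡ suc (suc m) × IsLength n (gen n i ∘ z ∘ gen n i) m) → Reduction z k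
      shorten {i} ok (m , k≡ , len′) = subst (Reduction z) (sym k≡) (conj-reduction ok
        (recurse (subst (m ℕ.<_) (sym k≡) (ℕ.s≤s (ℕₚ.n≤1+n m))) (fixedPointFree-conj fz i) len′))
      go : (∃ λ i → i ℕ.< n × AdjacentDescent z (+ suc i)) ⊎ (∀ x → ¬ AdjacentDescent z x) → Reduction z k
      go (inj₂ none) = Θ-reduction (no-adjacent-descent⇒Θ fz none) len
      go (inj₁ (i , i<n , d)) = shorten ok (conj-shortens fz ok d len)
        where
        ok : InRange n (suc i)
        ok = ℕ.s≤s ℕ.z≤n , i<n

  reduce : ∀ {k} → Acc ℕ._<_ k → ∀ {z} → FixedPointFree z → IsLength n z k → Reduction z k
  reduce (acc rec) = reduce-step (λ m<k → reduce (rec m<k))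

-- Atoms of y and z, and the bijection

module Main (h : ℕ) (2≤n : 2 ℕ.≤ h ℕ.* 2) where

  open Theta h 2≤n
  open Words n 2≤n
  open FPF h 2≤n
  open Reflection

  fixedPointFree : ∀ {z} → IsFPFInv n z → FixedPointFree z
  fixedPointFree (a , inv) = record
    { affine = affPerm⇒affine n a ; zz = λ x → proj₁ (inv x) ; free = λ x → proj₂ (inv x) }

  conj-swap : ∀ {y z r} → Reflection n r → z ≈ (r ∘ y ∘ r) → y ≈ (r ∘ z ∘ r)
  conj-swap {y} {z} {r} R e x = trans (trans (cong y (sym (invol R x))) (sym (invol R _))) (cong r (sym (e (r x))))

  module _ {z : Map} {k : ℕ} (red : Reduction z k) (len : IsLength n z k) where

    open Reduction red

    -- Writing `z` as the inverse of `u`, then Θ, then `u` gives a word of length 2 m + ℓ(Θ), too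
    -- short for `z` if m < `size`.
    size-least : ∀ {u m} → HasWord n u m → (Θ n sign ∘ u) ≈ (u ∘ z) → size ℕ.≤ m
    size-least {u} {m} uw e = ℕₚ.≮⇒≥ λ m<size → ℕₚ.<⇒≱ (shorter m<size) (isLength-≤ len zw)
      where
      open Affine (hasWord-affine uw)
      zw : HasWord n z (m ℕ.+ (Θ-size ℕ.+ m))
      zw = hasWord-≈ (λ x → trans (cong inverse (e x)) (inverseˡ _))
             (hasWord-∘ (hasWord-inverse inverseʳ uw) (hasWord-∘ (proj₁ Θ-len) uw))
      shorter : m ℕ.< size → m ℕ.+ (Θ-size ℕ.+ m) ℕ.< k
      shorter m<size = subst₂ ℕ._<_ (lem m Θ-size) (sym total) (ℕₚ.+-monoˡ-< Θ-size (ℕₚ.+-mono-< m<size m<size))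
        where
        lem : ∀ m c → m ℕ.+ m ℕ.+ c ≡ m ℕ.+ (c ℕ.+ m)
        lem = ℕ-Solver.solve-∀

    v-length : IsLength n v size
    v-length = v-word , λ { w ok p → size-least (w , ok , refl , p) v-conj }

    same-sign : ∀ {u} b → Affine n u → (Θ n b ∘ u) ≈ (u ∘ z) → b ≡ sign
    same-sign b au e = same-Θ {b = b} au (hasWord-affine v-word) e v-conj

    atom-least : ∀ {u m} b → Affine n u → (Θ n b ∘ u) ≈ (u ∘ z) → HasWord n u m → size ℕ.≤ m
    atom-least {u} b au e uw = size-least uw (subst (λ b → (Θ n b ∘ u) ≈ (u ∘ z)) (same-sign b au e) e)

    atom : ∀ {u} → Affine n u → (Θ n sign ∘ u) ≈ (u ∘ z) → IsLength n u size → AFPF n z u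
    atom au e ℓ = affine⇒affPerm n au , sign , e , size , ℓ , λ u′ a′ e′ m ℓ′ → atom-least sign (affPerm⇒affine n a′) e′ (proj₁ ℓ′)

    -- The sign in `AFPF` is existential; `same-sign` identifies it with that of the reduction, so
    -- that all atoms share one Θ and one length.
    atom⁻¹ : ∀ {u} → AFPF n z u → Affine n u × (Θ n sign ∘ u) ≈ (u ∘ z) × IsLength n u size
    atom⁻¹ {u} (a , b , e , m , ℓ , least) with same-sign b (affPerm⇒affine n a) e
    ... | refl = affPerm⇒affine n a , e , subst (IsLength n u) (ℕₚ.≤-antisym
            (least v (affine⇒affPerm n (hasWord-affine v-word)) v-conj size v-length)
            (size-least (proj₁ ℓ) e)) ℓ

  -- Otherwise `π` itself would be inverted along `t`, and exchange would make `π ∘ t` shorter than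
  -- `π`.
  cover-descends : ∀ {π t} → Reflection n t → Cover n π (π ∘ t) → Descends t (π ∘ t)
  cover-descends {π} {t} T (_ , _ , _ , k , ℓ , ℓ′)
    with ascends⊎descends n {t} {π ∘ t} T (shift-∘ n {π} {t} (hasWord-shift (proj₁ ℓ)) (shift T)) (λ e → inj T (hasWord-injective (proj₁ ℓ) e))
  ... | inj₂ desc = desc
  ... | inj₁ asc with ascending-point n T
  ...   | i , i<ti with exchange T i<ti (subst (λ a → π (t i) < π a) (invol T i) (asc i i<ti)) (proj₁ ℓ)
  ...     | m , refl , word = contradiction (isLength-≤ ℓ′ word) (ℕₚ.<⇒≱ (ℕ.s≤s (ℕₚ.n≤1+n m)))

  module _ {y z : Map} (Fz : FixedPointFree z) {t₀ : Map} (T₀ : Reflection n t₀) (e₀ : z ≈ (t₀ ∘ y ∘ t₀))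
           {k : ℕ} (ℓy : IsLength n y k) (ℓz : IsLength n z (k ℕ.+ 2))
           (Ry : Reduction y k) (Rz : Reduction z (k ℕ.+ 2)) where

    private
      open FixedPointFree Fz
      module Y = Reduction Ry
      module Z = Reduction Rz

      conj-reflect : ∀ b {u r} → Reflection n r → z ≈ (r ∘ y ∘ r) → (Θ n b ∘ u) ≈ (u ∘ z) → (Θ n b ∘ (u ∘ r)) ≈ ((u ∘ r) ∘ y)
      conj-reflect b {u} {r} R e c x = trans (c (r x)) (cong u (trans (e (r x)) (cong (r ∘ y) (invol R x))))

      conj-reflect⁻¹ : ∀ b {u r} → Reflection n r → z ≈ (r ∘ y ∘ r) → (Θ n b ∘ u) ≈ (u ∘ y) → (Θ n b ∘ (u ∘ r)) ≈ ((u ∘ r) ∘ z)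
      conj-reflect⁻¹ b {u} {r} R e c x = trans (c (r x)) (cong u (trans (sym (invol R _)) (cong r (sym (e x)))))

      affine-∘-reflection : ∀ {u r} → Affine n u → Reflection n r → Affine n (u ∘ r)
      affine-∘-reflection au R = affine-∘ n au (affine-reflection n R)

      signs : Z.sign ≡ Y.sign
      signs = same-sign Ry ℓy Z.sign (affine-∘-reflection (hasWord-affine Z.v-word) T₀) (conj-reflect Z.sign T₀ e₀ Z.v-conj)

      Θ-sizes : Z.Θ-size ≡ Y.Θ-size
      Θ-sizes = isLength-unique Z.Θ-len (subst (λ b → IsLength n (Θ n b) Y.Θ-size) (sym signs) Y.Θ-len)

      -- The two lengths differ by 2 and the contributions of Θ cancel, both reductions ending at
      -- the same Θ.
      sizes : Z.size ≡ suc Y.size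
      sizes = ℕₚ.*-cancelˡ-≡ Z.size (suc Y.size) 2 (ℕₚ.+-cancelʳ-≡ Z.Θ-size _ _
        (trans (lem₁ Z.size Z.Θ-size) (trans (sym Z.total) (trans (cong (ℕ._+ 2) Y.total) (trans (lem₂ Y.size Y.Θ-size) (cong (2 ℕ.* suc Y.size ℕ.+_) (sym Θ-sizes)))))))
        where
        lem₁ : ∀ a c → 2 ℕ.* a ℕ.+ c ≡ a ℕ.+ a ℕ.+ c
        lem₁ = ℕ-Solver.solve-∀
        lem₂ : ∀ a c → a ℕ.+ a ℕ.+ c ℕ.+ 2 ≡ 2 ℕ.* (1 ℕ.+ a) ℕ.+ c
        lem₂ = ℕ-Solver.solve-∀

      y≉z : ¬ (y ≈ z)
      y≉z e = ℕₚ.<⇒≢ (ℕₚ.m<m+n k (ℕ.s≤s ℕ.z≤n)) (isLength-unique ℓy (isLength-≈ (≈-sym e) ℓz))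

      -- A descent would shorten `Y.v ∘ r`, which intertwines Θ with `z`, to one letter less than
      -- `Y.size`, whereas `z` requires one letter more.
      v-ascends : ∀ {r} → Reflection n r → y ≈ (r ∘ z ∘ r) → Ascends r Y.v
      v-ascends {r} R e with ascends⊎descends n {r} {Y.v} R (hasWord-shift Y.v-word) (hasWord-injective Y.v-word)
      ... | inj₁ asc  = asc
      ... | inj₂ desc with ascending-point n R
      ...   | i , i<ri with exchange R i<ri (desc i i<ri) Y.v-word
      ...     | m , size≡ , word = contradiction
                (atom-least Rz ℓz Y.sign (affine-∘-reflection (hasWord-affine Y.v-word) R) (conj-reflect⁻¹ Y.sign R (conj-swap R e) Y.v-conj) word)
                (ℕₚ.<⇒≱ (subst (m ℕ.<_) (sym (trans sizes (cong suc size≡))) (ℕ.s≤s (ℕₚ.n≤1+n m))))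

    pair⇒atom : ∀ {π t} → GoodPair n y z π t → AFPF n z (π ∘ t)
    pair⇒atom {π} {t} (aπ , isT , (_ , affπt , _ , k , ℓ , ℓ′) , e) with atom⁻¹ Ry ℓy aπ
    ... | aff , c , ℓπ = atom Rz ℓz (affine-∘-reflection aff T)
            (subst (λ b → (Θ n b ∘ (π ∘ t)) ≈ ((π ∘ t) ∘ z)) (sym signs) (conj-reflect⁻¹ Y.sign T e c))
            (subst (IsLength n (π ∘ t)) (trans (cong suc (isLength-unique ℓ ℓπ)) (sym sizes)) ℓ′)
      where
      T : Reflection n t
      T = isReflection⇒reflection n isT

    module _ {w : Map} (aw : AFPF n z w) where

      private
        affw : Affine n w
        affw = proj₁ (atom⁻¹ Rz ℓz aw)
        ℓw : IsLength n w Z.size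
        ℓw = proj₂ (proj₂ (atom⁻¹ Rz ℓz aw))
        cw : (Θ n Z.sign ∘ w) ≈ (w ∘ z)
        cw = proj₁ (proj₂ (atom⁻¹ Rz ℓz aw))
        cv : (Θ n Z.sign ∘ Y.v) ≈ (Y.v ∘ y)
        cv = subst (λ b → (Θ n b ∘ Y.v) ≈ (Y.v ∘ y)) (sym signs) Y.v-conj

      atom-descent : Σ Map λ r → Reflection n r × y ≈ (r ∘ z ∘ r) × Descends r w
      atom-descent = descending-conjugator y≉z (Θ-near Z.sign) (hasWord-shift Y.v-word) (hasWord-injective Y.v-word) cv
        (Affine.shift affw) (Affine.injective affw) cw v-ascends T₀ (conj-swap T₀ e₀)

      atom-descent-unique : ∀ {r r′} → Reflection n r → Reflection n r′ → z ≈ (r ∘ y ∘ r) → z ≈ (r′ ∘ y ∘ r′) →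
                            Descends r w → Descends r′ w → r ≈ r′
      atom-descent-unique R R′ e e′ = descending-conjugator-unique y≉z (Θ-near Z.sign) (hasWord-shift Y.v-word) (hasWord-injective Y.v-word) cv
        (Affine.shift affw) (Affine.injective affw) cw v-ascends R R′ (conj-swap R e) (conj-swap R′ e′)

      atom⇒pair : Σ Map λ π → Σ Map λ t → GoodPair n y z π t × (π ∘ t) ≈ w
      atom⇒pair with atom-descent
      ... | r , R , e , desc with ascending-point n R
      ...   | i , i<ri with exchange R i<ri (desc i i<ri) (proj₁ ℓw)
      ...     | m , size≡ , word = w ∘ r , r , (aπ , isR , (affine⇒affPerm n affπ , affine⇒affPerm n (affine-∘-reflection affπ R) ,
                  (r , isR , λ _ → refl) , Y.size , ℓπ , isLength-≈ (≈-sym back) (subst (IsLength n w) sizes ℓw)) , conj-swap R e) , back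
        where
        isR : IsReflection n r
        isR = reflection⇒isReflection n R
        back : (w ∘ r ∘ r) ≈ w
        back x = cong w (invol R x)
        affπ : Affine n (w ∘ r)
        affπ = affine-∘-reflection affw R
        cπ : (Θ n Y.sign ∘ (w ∘ r)) ≈ ((w ∘ r) ∘ y)
        cπ = subst (λ b → (Θ n b ∘ (w ∘ r)) ≈ ((w ∘ r) ∘ y)) signs (conj-reflect Z.sign R (conj-swap R e) cw)
        ℓπ : IsLength n (w ∘ r) Y.size
        ℓπ = subst (HasWord n (w ∘ r)) (ℕₚ.suc-injective (trans (sym size≡) sizes)) word ,
             λ { u ok p → size-least Ry ℓy (u , ok , refl , p) cπ }
        aπ : AFPF n y (w ∘ r)
        aπ = atom Ry ℓy affπ cπ ℓπ

    -- Both reflections are inversions of the common product, an atom of `z`, so they coincide;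
    -- cancelling them identifies `π` with `π′`.
    pair-unique : ∀ {π t π′ t′} → GoodPair n y z π t → GoodPair n y z π′ t′ → (π ∘ t) ≈ (π′ ∘ t′) → π ≈ π′ × t ≈ t′
    pair-unique {π} {t} {π′} {t′} p@(_ , isT , cov , e) (_ , isT′ , cov′ , e′) same = π≈ , t≈
      where
      T : Reflection n t
      T = isReflection⇒reflection n isT
      T′ : Reflection n t′
      T′ = isReflection⇒reflection n isT′
      t≈ : t ≈ t′
      t≈ = atom-descent-unique (pair⇒atom p) T T′ e e′ (cover-descends T cov)
             (λ x lt → subst₂ _<_ (sym (same _)) (sym (same _)) (cover-descends T′ cov′ x lt))
      π≈ : π ≈ π′
      π≈ x = trans (cong π (sym (invol T x))) (trans (same (t x)) (cong π′ (trans (cong t′ (t≈ x)) (invol T′ x))))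

theorem5p6 : (n : ℕ) → 2 ℕ.≤ n → 2 ℕ∣.∣ n → (y z : Map)
    → IsFPFInv n y → IsFPFInv n z → FPFCover n y z
    → ((π t : Map) → GoodPair n y z π t → AFPF n z (π ∘ t))
    × ((π t π′ t′ : Map) → GoodPair n y z π t → GoodPair n y z π′ t′
    → (π ∘ t) ≈ (π′ ∘ t′) → (π ≈ π′) × (t ≈ t′))
    × ((w : Map) → AFPF n z w
    → Σ Map λ π → Σ Map λ t → GoodPair n y z π t × (π ∘ t) ≈ w)
theorem5p6 n 2≤n (ℕ∣.divides h refl) y z fy fz ((t , isT , e) , k , ℓy , ℓz) =
  (λ _ _ → pair⇒atom Fz T e ℓy ℓz Ry Rz) ,
  (λ _ _ _ _ → pair-unique Fz T e ℓy ℓz Ry Rz) ,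
  (λ _ → atom⇒pair Fz T e ℓy ℓz Ry Rz)
  where
  open Main h 2≤n
  open FPF h 2≤n
  open Words (h ℕ.* 2) 2≤n using (n-nonZero)
  T : Reflection (h ℕ.* 2) t
  T = isReflection⇒reflection (h ℕ.* 2) isT
  Fz : FixedPointFree z
  Fz = fixedPointFree fz
  Ry : Reduction y k
  Ry = reduce (<-wellFounded k) (fixedPointFree fy) ℓy
  Rz : Reduction z (k ℕ.+ 2)
  Rz = reduce (<-wellFounded (k ℕ.+ 2)) Fz ℓz
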